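{- For every partition $\lambda$ and all integers $k,l\ge0$, $$\sum_{\alpha:\ \boldsymbol{\lambda}(\alpha)=\lambda}\mathcal{HQ}_\alpha(X;Y)=\sum_{\beta:\ \boldsymbol{\lambda}(\beta)=\lambda'}\mathcal{RHQ}_\beta(X;Y),$$ where $\lambda'$ is the conjugate partition, and $\boldsymbol{\lambda}(\alpha)$ denotes the partition obtained by sorting the parts of the composition $\alpha$ into weakly decreasing order.
   Context: Fix $k,l\ge0$, $\mathcal{A}=\{1,\dots,k\}$, $\mathcal{A}'=\{1',\dots,l'\}$ with total order $1<\dots<k<1'<\dots<l'$, $X=(x_1,\dots,x_k)$, $Y=(y_1,\dots,y_l)$. French notation: row $i$ is the $i$-th from the bottom; cell $(i,j)$ is in row $i$, column $j$. For a composition $\alpha=(\alpha_1,\dots,\alpha_r)$ with largest part $m$, its diagram has $\alpha_i$ cells in row $i$; for a filling $F$, $\hat F$ is the $r\times m$ array obtained by putting $\infty$ (larger than all letters, in neither alphabet) in the missing cells. A hook composition tableau (HCT) of shape $\alpha$ is a filling $F$ with letters of $\mathcal{A}\cup\mathcal{A}'$ such that: rows weakly increase left to right; unprimed entries weakly and primed entries strictly increase along rows; in the leftmost column unprimed entries strictly and primed entries weakly increase bottom to top; and for all $1\le i<j\le r$, $1\le n<m$: (a) if $\hat F(i,n+1)\in\mathcal{A}$ and $\hat F(i,n+1)\ge\hat F(j,n)$ then $\hat F(i,n+1)>\hat F(j,n+1)$; (b) if $\hat F(i,n+1)\in\mathcal{A}'$ and $\hat F(i,n+1)>\hat F(j,n)$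 then $\hat F(i,n+1)\ge \hat F(j,n+1)$. A row-strict hook composition tableau (RHCT) of shape $\alpha$ is a filling $F$ with letters of $\mathcal{A}\cup\mathcal{A}'$ such that: rows weakly increase left to right; unprimed entries strictly and primed entries weakly increase along rows; in the leftmost column unprimed entries weakly and primed entries strictly increase bottom to top; and for all $1\le i<j\le r$, $1\le n<m$: (a) if $\hat F(i,n+1)\in\mathcal{A}'$ and $\hat F(i,n+1)\ge\hat F(j,n)$ then $\hat F(i,n+1)>\hat F(j,n+1)$; (b) if $\hat F(i,n+1)\in\mathcal{A}$ and $\hat F(i,n+1)>\hat F(j,n)$ then $\hat F(i,n+1)\ge\hat F(j,n+1)$. $\mathcal{HQ}_\alpha(X;Y)$ (resp. $\mathcal{RHQ}_\alpha(X;Y)$) is the sum over all HCT (resp. RHCT) $F$ of shape $\alpha$ of $\prod_i x_i^{v_i}\prod_i y_i^{u_i}$, where $v_i$, $u_i$ are the numbers of entries $i$, $i'$ in $F$. -}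

module Defs where

open import Data.Nat using (ℕ; zero; suc; _≤_; _≥_; _≤ᵇ_; _<ᵇ_; _≡ᵇ_; _⊔_; _∸_; _<_)
import Data.Nat as ℕ
open import Data.Bool using (Bool; true; false; _∧_; _∨_; not; if_then_else_)
open import Data.Fin using (Fin; toℕ)
open import Data.Sum using (_⊎_; inj₁; inj₂)
open import Data.Maybe using (Maybe; just; nothing)
open import Data.Product using (_×_)
open import Data.List using (List; []; _∷_; _++_; map; concatMap; length; filterᵇ; allFin; upTo; foldr; take)
open import Data.Nat.ListAction using (sum)
open import Data.Bool.ListAction using (and)
open import Data.List.Relation.Unary.All using (All)
open import Data.List.Relation.Unary.Linked using (Linked)
open import Data.List.Properties using (≡-dec)
open import Data.Vec using (Vec; lookup)
open import Relation.Nullary.Decidable using (⌊_⌋)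

IsPartition : List ℕ → Set
IsPartition lam = All (λ p → 1 ≤ p) lam × Linked _≥_ lam

words : {A : Set} → List A → ℕ → List (List A)
words xs zero    = [] ∷ []
words xs (suc r) = concatMap (λ x → map (x ∷_) (words xs r)) xs

compositions : ℕ → List (List ℕ)
compositions n =
  filterᵇ (λ α → sum α ≡ᵇ n)
          (concatMap (words (map suc (upTo n))) (upTo (suc n)))

insertDesc : ℕ → List ℕ → List ℕ
insertDesc x []       = x ∷ []
insertDesc x (y ∷ ys) = if y ≤ᵇ x then x ∷ y ∷ ys else y ∷ insertDesc x ys

sortDesc : List ℕ → List ℕ
sortDesc = foldr insertDesc []

conjugate : List ℕ → List ℕ
conjugate lam =
  map (λ j → length (filterᵇ (λ p → suc j ≤ᵇ p) lam)) (upTo (foldr _⊔_ 0 lam))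

compositionsSortingTo : List ℕ → List (List ℕ)
compositionsSortingTo lam =
  filterᵇ (λ α → ⌊ ≡-dec ℕ._≟_ (sortDesc α) lam ⌋) (compositions (sum lam))

-- Letters: inj₁ i is the unprimed letter (toℕ i + 1) ∈ 𝒜 = {1,…,k},
-- inj₂ j is the primed letter (toℕ j + 1)' ∈ 𝒜' = {1',…,l'};
-- order 1 < … < k < 1' < … < l'.

Letter : ℕ → ℕ → Set
Letter k l = Fin k ⊎ Fin l

module _ {k l : ℕ} where

  unprimed : Letter k l → Bool
  unprimed (inj₁ _) = true
  unprimed (inj₂ _) = false

  primed : Letter k l → Bool
  primed a = not (unprimed a)

  ltL : Letter k l → Letter k l → Bool
  ltL (inj₁ a) (inj₁ b) = toℕ a <ᵇ toℕ b
  ltL (inj₁ a) (inj₂ b) = true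
  ltL (inj₂ a) (inj₁ b) = false
  ltL (inj₂ a) (inj₂ b) = toℕ a <ᵇ toℕ b

  eqL : Letter k l → Letter k l → Bool
  eqL (inj₁ a) (inj₁ b) = toℕ a ≡ᵇ toℕ b
  eqL (inj₁ a) (inj₂ b) = false
  eqL (inj₂ a) (inj₁ b) = false
  eqL (inj₂ a) (inj₂ b) = toℕ a ≡ᵇ toℕ b

  leL : Letter k l → Letter k l → Bool
  leL a b = ltL a b ∨ eqL a b

  -- entries of F̂ : a letter, or nothing = ∞ (larger than every letter)
  ltE : Maybe (Letter k l) → Maybe (Letter k l) → Bool
  ltE (just a) (just b) = ltL a b
  ltE (just a) nothing  = true
  ltE nothing  _        = false

  eqE : Maybe (Letter k l) → Maybe (Letter k l) → Bool
  eqE (just a) (just b) = eqL a b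
  eqE (just a) nothing  = false
  eqE nothing  (just b) = false
  eqE nothing  nothing  = true

  leE : Maybe (Letter k l) → Maybe (Letter k l) → Bool
  leE x y = ltE x y ∨ eqE x y

-- Fillings: a list of rows, row i (bottom = first) is a list of letters,
-- read left to right.  The shape of a filling F is map length F.
Filling : ℕ → ℕ → Set
Filling k l = List (List (Letter k l))

allLetters : (k l : ℕ) → List (Letter k l)
allLetters k l = map inj₁ (allFin k) ++ map inj₂ (allFin l)

fillings : (k l : ℕ) → List ℕ → List (Filling k l)
fillings k l []      = [] ∷ []
fillings k l (a ∷ α) =
  concatMap (λ w → map (w ∷_) (fillings k l α)) (words (allLetters k l) a)

at : {A : Set} → List A → ℕ → Maybe A
at []       _       = nothing
at (x ∷ xs) zero    = just x
at (x ∷ xs) (suc n) = at xs n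

-- F̂(i+1, n+1) in the paper's 1-based indexing; ∞ = nothing outside F
hat : {k l : ℕ} → Filling k l → ℕ → ℕ → Maybe (Letter k l)
hat F i n with at F i
... | nothing  = nothing
... | just row = at row n

consecutive : {A : Set} → (A → A → Bool) → List A → Bool
consecutive R []           = true
consecutive R (x ∷ [])     = true
consecutive R (x ∷ y ∷ xs) = R x y ∧ consecutive R (y ∷ xs)

module _ {k l : ℕ} where

  firstColumn : Filling k l → List (Letter k l)
  firstColumn F = concatMap (take 1) F

  -- Generic tableau condition.  `s` selects the letters that must increase
  -- strictly along rows (and weakly in the leftmost column); the other
  -- letters increase weakly along rows and strictly in the leftmost column.
  -- HCT: s = primed.   RHCT: s = unprimed.
  rowsOK : (Letter k l → Bool) → Filling k l → Bool
  rowsOK s F =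
    and (map (consecutive (λ a b → leL a b ∧ not (s a ∧ eqL a b))) F)

  columnOK : (Letter k l → Bool) → Filling k l → Bool
  columnOK s F =
    consecutive (λ a b → leL a b ∧ not (not (s a) ∧ eqL a b)) (firstColumn F)

  -- triple conditions, 0-based: rows i < j < r, columns n, n+1 with n+1 < m
  --  (a) if F̂(i,n+1) is a non-s letter and F̂(i,n+1) ≥ F̂(j,n)
  --        then F̂(i,n+1) > F̂(j,n+1);
  --  (b) if F̂(i,n+1) is an s letter and F̂(i,n+1) > F̂(j,n)
  --        then F̂(i,n+1) ≥ F̂(j,n+1).
  tripleOK : (Letter k l → Bool) → Filling k l → ℕ → ℕ → ℕ → Bool
  tripleOK s F i j n with hat F i (suc n)
  ... | nothing = true
  ... | just z  =
    if s z
      then (not (ltE (hat F j n) (just z)) ∨ leE (hat F j (suc n)) (just z))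
      else (not (leE (hat F j n) (just z)) ∨ ltE (hat F j (suc n)) (just z))

  triplesOK : (Letter k l → Bool) → Filling k l → Bool
  triplesOK s F =
    let r = length F
        m = foldr _⊔_ 0 (map length F)
    in and (map (λ i → and (map (λ j →
             if i <ᵇ j
               then and (map (λ n → tripleOK s F i j n) (upTo (m ∸ 1)))
               else true) (upTo r))) (upTo r))

  tableauOK : (Letter k l → Bool) → Filling k l → Bool
  tableauOK s F = rowsOK s F ∧ columnOK s F ∧ triplesOK s F

  isHCT : Filling k l → Bool
  isHCT = tableauOK primed

  isRHCT : Filling k l → Bool
  isRHCT = tableauOK unprimed

  occurrences : Letter k l → Filling k l → ℕ
  occurrences a F = sum (map (λ row → length (filterᵇ (eqL a) row)) F)

  hasContent : Filling k l → Vec ℕ k → Vec ℕ l → Bool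
  hasContent F v u =
    and (map (λ i → occurrences (inj₁ i) F ≡ᵇ lookup v i) (allFin k)) ∧
    and (map (λ j → occurrences (inj₂ j) F ≡ᵇ lookup u j) (allFin l))

-- Polynomials are represented by their coefficient functions:
-- coefficient of  x^v y^u = ∏ x_i^{v_i} ∏ y_j^{u_j}.

HQcoeff : (k l : ℕ) → List ℕ → Vec ℕ k → Vec ℕ l → ℕ
HQcoeff k l α v u =
  length (filterᵇ (λ F → isHCT F ∧ hasContent F v u) (fillings k l α))

RHQcoeff : (k l : ℕ) → List ℕ → Vec ℕ k → Vec ℕ l → ℕ
RHQcoeff k l α v u =
  length (filterᵇ (λ F → isRHCT F ∧ hasContent F v u) (fillings k l α))

sumHQcoeff : (k l : ℕ) → List ℕ → Vec ℕ k → Vec ℕ l → ℕ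
sumHQcoeff k l lam v u =
  sum (map (λ α → HQcoeff k l α v u) (compositionsSortingTo lam))

sumRHQcoeff : (k l : ℕ) → List ℕ → Vec ℕ k → Vec ℕ l → ℕ
sumRHQcoeff k l lam v u =
  sum (map (λ β → RHQcoeff k l β v u) (compositionsSortingTo lam))

{-# OPTIONS --safe #-}
module Submission where

-- Write R for the relation that consecutive entries of a row satisfy and C for
-- the one in the columns. Exchanging primed and unprimed letters exchanges R and
-- C, so transposition of semistandard tableaux turns a row-column type (R, C) of
-- shape λ into type (C, R) of shape λ′. It remains to match composition tableaux
-- whose shape sorts to λ with semistandard tableaux of shape λ. The triple
-- conditions concern pairs of rows, and exchanging the tails of two rows at the
-- right column is an involution that trades "the lower row lies entrywise below
-- the upper one" for "the two rows satisfy the triple conditions". Inserting the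
-- rows of a semistandard tableau one after the other by such exchanges gives the
-- bijection; lengths and letters of rows are only permuted.

open import Defs
open import Level using (0ℓ)
open import Data.Bool using (Bool; true; false; T; _∧_; _∨_; not; if_then_else_)
open import Data.Bool.ListAction using (and)
open import Data.Bool.Properties using (T-∧; T-∨; T?; not-involutive)
open import Data.Empty using (⊥; ⊥-elim)
open import Data.Fin using (Fin; toℕ)
open import Data.Fin.Properties using (toℕ-injective; toℕ<n)
open import Data.List
  using (List; []; _∷_; _++_; map; concat; concatMap; length; foldr; filterᵇ; upTo; applyUpTo;
         allFin; cartesianProductWith)
open import Data.List.Membership.Propositional using (_∈_; find; lose)
open import Data.List.Membership.Propositional.Properties
open import Data.List.NonEmpty as List⁺ using (List⁺; _∷_; _∷⁺_; toList)
open import Data.List.Properties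
  using (∷-injective; ++-identityʳ; map-upTo; length-applyUpTo; length-++; filter-++; map-cong;
         map-∘; map-injective; ≡-dec)
open import Data.List.Relation.Binary.Disjoint.Propositional using (Disjoint)
open import Data.List.Relation.Binary.Permutation.Propositional
  using (_↭_; prep; swap; ↭-refl; ↭-sym; ↭-trans; ↭-reflexive; ↭⇒↭ₛ′; module PermutationReasoning)
import Data.List.Relation.Binary.Permutation.Propositional.Properties as ↭
open import Data.List.Relation.Binary.Pointwise using (Pointwise-≡⇒≡)
open import Data.List.Relation.Binary.Prefix.Heterogeneous as Prefix using (Prefix; []; _∷_)
open import Data.List.Relation.Binary.Prefix.Heterogeneous.Properties using (length-mono)
open import Data.List.Relation.Unary.All as All using (All; []; _∷_)
import Data.List.Relation.Unary.All.Properties as All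
open import Data.List.Relation.Unary.AllPairs as AllPairs using (AllPairs; []; _∷_)
import Data.List.Relation.Unary.AllPairs.Properties as AllPairs
open import Data.List.Relation.Unary.Any using (here; there)
open import Data.List.Relation.Unary.Linked as Linked using (Linked; []; [-]; _∷_)
open import Data.List.Relation.Unary.Linked.Properties as Linked using (Linked⇒AllPairs; AllPairs⇒Linked)
open import Data.List.Relation.Unary.Sorted.TotalOrder.Properties using (↗↭↗⇒≋)
open import Data.List.Relation.Unary.Unique.Propositional using (Unique)
import Data.List.Relation.Unary.Unique.Propositional.Properties as Unique
open import Data.Maybe using (Maybe; just; nothing)
open import Data.Nat using (ℕ; zero; suc; _+_; _∸_; _⊔_; _≤_; _≥_; _<_; _≤ᵇ_; _<ᵇ_; _≡ᵇ_; z≤n; s≤s; s≤s⁻¹)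
open import Data.Nat.ListAction using (sum)
open import Data.Nat.ListAction.Properties using (sum-↭)
open import Data.Nat.Properties as ℕ using (≤-trans)
open import Data.Product using (_×_; _,_; proj₁; proj₂; ∃; ∃₂; -,_)
open import Data.Sum using (_⊎_; inj₁; inj₂)
open import Data.Unit using (tt)
open import Data.Vec using (Vec; lookup)
open import Function using (_∘_; flip; id; case_of_; _⇔_; mk⇔; Equivalence)
open import Relation.Binary using (Rel; Transitive; tri<; tri≈; tri>)
import Relation.Binary.Construct.Flip.EqAndOrd as Flip
open import Relation.Binary.PropositionalEquality
  using (_≡_; _≢_; refl; sym; trans; cong; cong₂; subst; isEquivalence; module ≡-Reasoning)
open import Relation.Nullary using (yes; no)
open import Relation.Nullary.Decidable using (⌊_⌋; toWitness; fromWitness)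

open Equivalence using (to; from)

-- An exchange repairs one pair of rows but touches every other pair, so the work lies in the third
-- rows. Rows already passed must satisfy the triple conditions with both results
-- (`swapRows-upper`). A row still to be met must keep the triple conditions with the rows above it
-- and stay entrywise above the moving row (`swapRows-lower`); this holds because the moving row
-- travels downwards. Semistandard rows inserted later must remain entrywise below everything
-- (`swapRows-below`). The correspondence between the two sides is kept as a relation that is total
-- and injective, which yields one inequality between finite counts. The other inequality is the
-- same statement with the alphabets exchanged and λ replaced by λ′, since λ″ = λ. Injectivity of
-- transposition thus takes the place of an inverse.

Tableau : Set → Set
Tableau A = List (List⁺ A)

-- R a b fails exactly when C b a holds. Semistandardness and the triple
-- conditions can be phrased with R and C alone, without the order on the letters.
record Complementary {A : Set} (R C : Rel A 0ℓ) : Set where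
  field
    compare  : ∀ a b → R a b ⊎ C b a
    exclude  : ∀ {a b} → R a b → C b a → ⊥
    R-trans  : Transitive R
    C-trans  : Transitive C

  RC⇒R : ∀ {a b c} → R a b → C b c → R a c
  RC⇒R {a} {c = c} rab cbc with compare a c
  ... | inj₁ rac = rac
  ... | inj₂ cca = ⊥-elim (exclude rab (C-trans cbc cca))

  CR⇒C : ∀ {a b c} → C a b → R b c → C a c
  CR⇒C {a} {c = c} cab rbc with compare c a
  ... | inj₁ rca = ⊥-elim (exclude (R-trans rbc rca) cab)
  ... | inj₂ cac = cac

  CR⇒R : ∀ {a b c} → C a b → R b c → R a c
  CR⇒R {a} {c = c} cab rbc with compare a c
  ... | inj₁ rac = rac
  ... | inj₂ cca = ⊥-elim (exclude rbc (C-trans cca cab))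

-- Comparisons and exchanges of rows, as relations

module _ {A : Set} (R C : Rel A 0ℓ) where

  infix 4 _◁_ _⊑_

  -- `Prefix` combines the entrywise comparison with the shape condition that the upper row is not
  -- longer than the lower one.
  _◁_ : Rel (List⁺ A) 0ℓ
  t ◁ u = Prefix (flip C) (toList u) (toList t)

  -- Dominates u us ts: the triple conditions between an upper row u ∷ us and a
  -- lower row whose entries from the second column of u on are ts.
  data Dominates : A → List A → List A → Set where
    end  : ∀ {u us} → Dominates u us []
    stop : ∀ {u t ts} → C t u → Dominates u [] (t ∷ ts)
    step : ∀ {u v us t ts} → (R u t → C v t) → Dominates v us ts →
           Dominates u (v ∷ us) (t ∷ ts)

  data _⊑_ : Rel (List⁺ A) 0ℓ where
    _,_ : ∀ {t ts u us} → C t u → Dominates u us ts → (t ∷ ts) ⊑ (u ∷ us)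

  RowOK : List⁺ A → Set
  RowOK = Linked R ∘ toList

  Semistandard : Tableau A → Set
  Semistandard T = All RowOK T × AllPairs _◁_ T

  Composition : Tableau A → Set
  Composition F = All RowOK F × AllPairs _⊑_ F

  -- Swap u us ts us′ ts′: the tails us and ts of an upper row u ∷ us and a lower
  -- row are exchanged from the first column at which that keeps the upper row an
  -- R-chain.
  data Swap : A → List A → List A → List A → List A → Set where
    end   : ∀ {u us} → Swap u us [] [] us
    cross : ∀ {u us t ts} → R u t → Swap u us (t ∷ ts) (t ∷ ts) us
    stop  : ∀ {u t ts} → C t u → Swap u [] (t ∷ ts) [] (t ∷ ts)
    keep  : ∀ {u t v us ts us′ ts′} → C t u → Swap v us ts us′ ts′ →
            Swap u (v ∷ us) (t ∷ ts) (v ∷ us′) (t ∷ ts′)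

  data SwapRows : List⁺ A → List⁺ A → List⁺ A → List⁺ A → Set where
    rows : ∀ {u us t ts us′ ts′} → Swap u us ts us′ ts′ →
           SwapRows (u ∷ us) (t ∷ ts) (u ∷ us′) (t ∷ ts′)

  -- Tableaux list their rows bottom first, so t meets the last row of F first.
  data Insert : List⁺ A → Tableau A → List⁺ A → Tableau A → Set where
    []  : ∀ {t} → Insert t [] t []
    _∷_ : ∀ {t F t′ F′ f f′ t″} → SwapRows f t′ f′ t″ → Insert t F t′ F′ →
          Insert t (f ∷ F) t″ (f′ ∷ F′)

  -- The top row is inserted first, so each new row lies entrywise below every row that it meets.
  data Build : Tableau A → Tableau A → Set where
    []  : Build [] []
    _∷_ : ∀ {t T F t′ F′} → Insert t F t′ F′ → Build T F →
          Build (t ∷ T) (t′ ∷ F′)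

-- The exchange of two tails

module _ {A : Set} {R C : Rel A 0ℓ} (RC : Complementary R C) where

  open Complementary RC

  private
    infix 4 _≼_

    _≼_ : Rel (List A) 0ℓ
    ts ≼ us = Prefix (flip C) us ts

  swap-total : ∀ u us ts → ∃₂ λ us′ ts′ → Swap R C u us ts us′ ts′
  swap-total u us [] = -, -, end
  swap-total u us (t ∷ ts) with compare u t
  swap-total u us       (t ∷ ts) | inj₁ r = -, -, cross r
  swap-total u []       (t ∷ ts) | inj₂ c = -, -, stop c
  swap-total u (v ∷ us) (t ∷ ts) | inj₂ c =
    let _ , _ , s = swap-total v us ts in -, -, keep c s

  swap-det : ∀ {u us ts as bs as′ bs′} →
             Swap R C u us ts as bs → Swap R C u us ts as′ bs′ → as ≡ as′ × bs ≡ bs′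
  swap-det end        end         = refl , refl
  swap-det (cross _)  (cross _)   = refl , refl
  swap-det (cross r)  (stop c)    = ⊥-elim (exclude r c)
  swap-det (cross r)  (keep c _)  = ⊥-elim (exclude r c)
  swap-det (stop _)   (stop _)    = refl , refl
  swap-det (stop c)   (cross r)   = ⊥-elim (exclude r c)
  swap-det (keep c _) (cross r)   = ⊥-elim (exclude r c)
  swap-det (keep _ s) (keep _ s′) with refl , refl ← swap-det s s′ = refl , refl

  -- The inverse exchange finds the same column: the comparisons before it are unchanged, and there
  -- the old continuation `v` of the upper row satisfies `R u v` because that row was an `R`-chain.
  swap-sym : ∀ {u us ts us′ ts′} → Linked R (u ∷ us) →
             Swap R C u us ts us′ ts′ → Swap R C u us′ ts′ us ts
  swap-sym [-]     end        = end
  swap-sym (r ∷ _) end        = cross r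
  swap-sym [-]     (cross _)  = end
  swap-sym (r ∷ _) (cross _)  = cross r
  swap-sym _       (stop c)   = stop c
  swap-sym (_ ∷ k) (keep c s) = keep c (swap-sym k s)

  relink : ∀ {t u us} → C t u → Linked R (u ∷ us) → Linked R (t ∷ us)
  relink c [-]     = [-]
  relink c (r ∷ k) = CR⇒R c r ∷ k

  swap-linked : ∀ {t u us ts us′ ts′} → C t u →
                Linked R (u ∷ us) → Linked R (t ∷ ts) → Swap R C u us ts us′ ts′ →
                Linked R (u ∷ us′) × Linked R (t ∷ ts′)
  swap-linked c ku       kt       end        = [-] , relink c ku
  swap-linked c ku       (_ ∷ kt) (cross r)  = r ∷ kt , relink c ku
  swap-linked c ku       kt       (stop _)   = ku , kt
  swap-linked c (r ∷ ku) (q ∷ kt) (keep d s) =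
    -- `CR⇒C d r` carries the comparison of the two rows one column to the right.
    let ku′ , kt′ = swap-linked (CR⇒C d r) ku kt s in r ∷ ku′ , q ∷ kt′

  ≼⇒Dominates : ∀ {x ts us} → ts ≼ us → Dominates R C x ts us
  ≼⇒Dominates []      = end
  ≼⇒Dominates (c ∷ p) = step (λ _ → c) (≼⇒Dominates p)

  -- Once `C u t` holds in a column, `R` along the lower row makes the premise of the next triple
  -- true, so `C` spreads to the right; for the same reason the upper row cannot end first.
  Dominates⇒≼ : ∀ {u us t ts} → C u t → Linked R (t ∷ ts) →
                Dominates R C u us ts → us ≼ ts
  Dominates⇒≼ c k       end        = []
  Dominates⇒≼ c (r ∷ k) (stop d)   = ⊥-elim (exclude (CR⇒R c r) d)
  Dominates⇒≼ c (r ∷ k) (step f d) = let c′ = f (CR⇒R c r) in c′ ∷ Dominates⇒≼ c′ k d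

  -- Before the exchange `C t u` refutes the triple premise `R u t`. After it the old lower tail is
  -- on top, and its entrywise comparison with the old upper tail gives each triple conclusion
  -- outright.
  swap-dominates : ∀ {u us ts us′ ts′} → ts ≼ us → Swap R C u us ts us′ ts′ →
                   Dominates R C u us′ ts′
  swap-dominates []      end        = end
  swap-dominates []      (cross _)  = end
  swap-dominates (c ∷ p) (cross _)  = step (λ _ → c) (≼⇒Dominates p)
  swap-dominates p       (stop c)   = stop c
  swap-dominates (_ ∷ p) (keep c s) =
    step (λ r → ⊥-elim (exclude r c)) (swap-dominates p s)

  -- Before the exchange `C t u` and `R u v` give `C t v`. At the exchange the triple premise
  -- `R u t` holds, and its conclusion spreads to the right by `Dominates⇒≼`.
  swap-sorts : ∀ {u us ts us′ ts′} → Linked R (u ∷ us) → Linked R ts →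
               Dominates R C u us ts → Swap R C u us ts us′ ts′ → ts′ ≼ us′
  swap-sorts ku      kt _          end        = []
  swap-sorts ku      kt (stop c)   (cross r)  = ⊥-elim (exclude r c)
  swap-sorts ku      kt (step f d) (cross r)  = f r ∷ Dominates⇒≼ (f r) kt d
  swap-sorts ku      kt _          (stop _)   = []
  swap-sorts (r ∷ k) kt (step _ d) (keep c s) = CR⇒C c r ∷ swap-sorts k (Linked.tail kt) d s

  -- `fs` belongs to a third row, entrywise above the moving row. At the exchange `R u t` and
  -- `C t f` give `R u f`, so the triple with that row applies and puts the released upper tail
  -- entrywise below `fs`.
  swap-lower : ∀ {u us ts us′ ts′ fs} → Linked R fs →
               Dominates R C u us fs → ts ≼ fs → Swap R C u us ts us′ ts′ →
               Dominates R C u us′ fs × ts′ ≼ fs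
  swap-lower k d          []      end        = end , []
  swap-lower k d          []      (cross _)  = end , []
  swap-lower k (stop d)   (c ∷ p) (cross r)  = ⊥-elim (exclude (RC⇒R r c) d)
  swap-lower k (step f d) (c ∷ p) (cross r)  =
    let c′ = f (RC⇒R r c) in
    step (λ _ → c) (≼⇒Dominates p) , c′ ∷ Dominates⇒≼ c′ k d
  swap-lower k d          p       (stop _)   = d , p
  swap-lower k d          []      (keep _ _) = end , []
  swap-lower k (step f d) (c ∷ p) (keep _ s) =
    let d′ , p′ = swap-lower (Linked.tail k) d p s in step f d′ , c ∷ p′

  -- For a fixed upper row each triple involves a single entry of the lower row, so exchanging the
  -- tails of two lower rows at a common column preserves the conditions.
  swap-upper : ∀ {u us ts us′ ts′ g gs} →
               Dominates R C g gs us → Dominates R C g gs ts → Swap R C u us ts us′ ts′ →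
               Dominates R C g gs us′ × Dominates R C g gs ts′
  swap-upper d          e          end        = e , d
  swap-upper d          e          (cross _)  = e , d
  swap-upper d          e          (stop _)   = d , e
  swap-upper (stop c)   (stop c′)  (keep _ _) = stop c , stop c′
  swap-upper (step f d) (step g e) (keep _ s) =
    let d′ , e′ = swap-upper d e s in step f d′ , step g e′

  swap-≼ : ∀ {u us ts us′ ts′ xs} → xs ≼ us → xs ≼ ts → Swap R C u us ts us′ ts′ →
           xs ≼ us′ × xs ≼ ts′
  swap-≼ p       q       end        = q , p
  swap-≼ p       q       (cross _)  = q , p
  swap-≼ p       q       (stop _)   = p , q
  swap-≼ (c ∷ p) (e ∷ q) (keep _ s) = let p′ , q′ = swap-≼ p q s in c ∷ p′ , e ∷ q′

  private
    infix 4 _⊲_ _⊴_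
    _⊲_ = _◁_ R C
    _⊴_ = _⊑_ R C

  swapRows-total : ∀ f t → ∃₂ λ f′ t′ → SwapRows R C f t f′ t′
  swapRows-total (u ∷ us) (t ∷ ts) = let _ , _ , s = swap-total u us ts in -, -, rows s

  swapRows-sym : ∀ {f t f′ t′} → RowOK R C f → SwapRows R C f t f′ t′ → SwapRows R C f′ t′ f t
  swapRows-sym k (rows s) = rows (swap-sym k s)

  swapRows-det : ∀ {f t f₁ t₁ f₂ t₂} →
                 SwapRows R C f t f₁ t₁ → SwapRows R C f t f₂ t₂ → f₁ ≡ f₂ × t₁ ≡ t₂
  swapRows-det (rows s) (rows s′) with refl , refl ← swap-det s s′ = refl , refl

  swapRows-injective : ∀ {f₁ t₁ f₂ t₂ f t} → RowOK R C f₁ → RowOK R C f₂ →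
                       SwapRows R C f₁ t₁ f t → SwapRows R C f₂ t₂ f t → f₁ ≡ f₂ × t₁ ≡ t₂
  swapRows-injective k₁ k₂ s₁ s₂ = swapRows-det (swapRows-sym k₁ s₁) (swapRows-sym k₂ s₂)

  swapRows-RowOK : ∀ {f t f′ t′} → C (List⁺.head t) (List⁺.head f) →
                   RowOK R C f → RowOK R C t → SwapRows R C f t f′ t′ →
                   RowOK R C f′ × RowOK R C t′
  swapRows-RowOK c kf kt (rows s) = swap-linked c kf kt s

  swapRows-⊑ : ∀ {f t f′ t′} → t ⊲ f → SwapRows R C f t f′ t′ → t′ ⊴ f′
  swapRows-⊑ (c ∷ p) (rows s) = c , swap-dominates p s

  swapRows-◁ : ∀ {f t f′ t′} → RowOK R C f → RowOK R C t → t ⊴ f →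
               SwapRows R C f t f′ t′ → t′ ⊲ f′
  swapRows-◁ kf kt (c , d) (rows s) = c ∷ swap-sorts kf (Linked.tail kt) d s

  swapRows-lower : ∀ {f t f′ t′ x} → RowOK R C x → x ⊴ f → t ⊲ x →
                   SwapRows R C f t f′ t′ → x ⊴ f′ × t′ ⊲ x
  swapRows-lower k (c , d) (e ∷ p) (rows s) =
    let d′ , p′ = swap-lower (Linked.tail k) d p s in (c , d′) , e ∷ p′

  swapRows-upper : ∀ {f t f′ t′ g} → f ⊴ g → t ⊴ g → SwapRows R C f t f′ t′ →
                   f′ ⊴ g × t′ ⊴ g
  swapRows-upper (c , d) (e , p) (rows s) =
    let d′ , p′ = swap-upper d p s in (c , d′) , (e , p′)

  swapRows-below : ∀ {f t f′ t′ x} → x ⊲ f → x ⊲ t → SwapRows R C f t f′ t′ →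
                   x ⊲ f′ × x ⊲ t′
  swapRows-below (c ∷ d) (e ∷ p) (rows s) =
    let d′ , p′ = swap-≼ d p s in (c ∷ d′) , (e ∷ p′)

  ◁-head : ∀ {t f} → t ⊲ f → C (List⁺.head t) (List⁺.head f)
  ◁-head (c ∷ _) = c

  ⊑-head : ∀ {t f} → t ⊴ f → C (List⁺.head t) (List⁺.head f)
  ⊑-head (c , _) = c

  -- Insertion of one row

  insert-total : ∀ t F → ∃₂ λ t′ F′ → Insert R C t F t′ F′
  insert-total t []      = -, -, []
  insert-total t (f ∷ F) =
    let t′ , _ , i = insert-total t F
        _ , _ , s = swapRows-total f t′
    in -, -, s ∷ i

  insert-det : ∀ {t F t₁ F₁ t₂ F₂} →
               Insert R C t F t₁ F₁ → Insert R C t F t₂ F₂ → t₁ ≡ t₂ × F₁ ≡ F₂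
  insert-det []      []        = refl , refl
  insert-det (s ∷ i) (s′ ∷ i′)
    with refl , refl ← insert-det i i′
    with refl , refl ← swapRows-det s s′ = refl , refl

  insert-injective : ∀ {t₁ F₁ t₂ F₂ t F} → All (RowOK R C) F₁ → All (RowOK R C) F₂ →
                     Insert R C t₁ F₁ t F → Insert R C t₂ F₂ t F → t₁ ≡ t₂ × F₁ ≡ F₂
  insert-injective []        []        []      []        = refl , refl
  insert-injective (k₁ ∷ K₁) (k₂ ∷ K₂) (s ∷ i) (s′ ∷ i′)
    with refl , refl ← swapRows-injective k₁ k₂ s s′
    with refl , refl ← insert-injective K₁ K₂ i i′ = refl , refl

  -- Here `x` is the row met after all of `F`; `t′ ⊲ x` is what the exchange with `x` requires.
  insert-lower : ∀ {x t F t′ F′} → RowOK R C x → All (x ⊴_) F → t ⊲ x →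
                 Insert R C t F t′ F′ → All (x ⊴_) F′ × t′ ⊲ x
  insert-lower k []      p []      = [] , p
  insert-lower k (d ∷ D) p (s ∷ i) =
    let D′ , p′ = insert-lower k D p i
        d′ , p″ = swapRows-lower k d p′ s
    in d′ ∷ D′ , p″

  insert-below : ∀ {x t F t′ F′} → All (x ⊲_) F → x ⊲ t →
                 Insert R C t F t′ F′ → All (x ⊲_) (t′ ∷ F′)
  insert-below []      p []      = p ∷ []
  insert-below (q ∷ Q) p (s ∷ i) with p′ ∷ Q′ ← insert-below Q p i =
    let q′ , p″ = swapRows-below q p′ s in p″ ∷ q′ ∷ Q′

  insert-composition : ∀ {t F t′ F′} → RowOK R C t → Composition R C F → All (t ⊲_) F →
                       Insert R C t F t′ F′ → Composition R C (t′ ∷ F′)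
  insert-composition kt _                  _       []      = (kt ∷ []) , ([] ∷ [])
  insert-composition kt (kf ∷ K , pf ∷ P) (q ∷ Q) (s ∷ i)
    with kt′ ∷ K′ , pt′ ∷ P′ ← insert-composition kt (K , P) Q i =
    let pf′ , t◁f = insert-lower kf pf q i
        kf′ , kt″ = swapRows-RowOK (◁-head t◁f) kf kt′ s
        uppers    = All.zipWith (λ (a , b) → swapRows-upper a b s) (pf′ , pt′)
    in kt″ ∷ kf′ ∷ K′
     , (swapRows-⊑ t◁f s ∷ All.map proj₂ uppers) ∷ All.map proj₁ uppers ∷ P′

  -- The last component lets the induction compare the next lower row, already
  -- restored, with the rows above it that are restored later.
  insert-surjective : ∀ {t′ F′} → Composition R C (t′ ∷ F′) →
    ∃₂ λ t F → Insert R C t F t′ F′ × RowOK R C t × Composition R C F × All (t ⊲_) F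
             × (∀ {x} → RowOK R C x → All (x ⊴_) F′ → t′ ⊲ x → All (x ⊴_) F × t ⊲ x)
  insert-surjective {F′ = []} (kt ∷ [] , _) =
    -, -, [] , kt , ([] , []) , [] , λ _ _ p → [] , p
  insert-surjective {t″} {f′ ∷ F′} (kt″ ∷ kf′ ∷ K′ , (q ∷ pt) ∷ pf ∷ P) =
    let f , t′ , s = swapRows-total f′ t″
        kf , kt′ = swapRows-RowOK (⊑-head q) kf′ kt″ s
        t′◁f     = swapRows-◁ kf′ kt″ q s
        uppers   = All.zipWith (λ (a , b) → swapRows-upper a b s) (pf , pt)
        t , F , i , kt , (K , P) , Q , lower =
          insert-surjective (kt′ ∷ K′ , All.map proj₂ uppers ∷ P)
        f⊑F , t◁f = lower kf (All.map proj₁ uppers) t′◁f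
    in t , f ∷ F , swapRows-sym kf′ s ∷ i , kt , (kf ∷ K , f⊑F ∷ P) , t◁f ∷ Q
     , λ where
         kx (d ∷ D) p →
           let d′ , p′ = swapRows-lower kx d p s
               D′ , p″ = lower kx D p′
           in d′ ∷ D′ , p″

  insert-below⁻ : ∀ {x t F t′ F′} → All (RowOK R C) F → All (x ⊲_) (t′ ∷ F′) →
                  Insert R C t F t′ F′ → All (x ⊲_) (t ∷ F)
  insert-below⁻ []      Q           []      = Q
  insert-below⁻ (k ∷ K) (p ∷ q ∷ Q) (s ∷ i) =
    let q′ , p′ = swapRows-below q p (swapRows-sym k s)
    in case insert-below⁻ K (p′ ∷ Q) i of λ { (p″ ∷ Q′) → p″ ∷ q′ ∷ Q′ }

  -- Semistandard tableaux and composition tableaux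

  build-total : ∀ T → ∃ (Build R C T)
  build-total []      = -, []
  build-total (t ∷ T) =
    let F , b = build-total T ; _ , _ , i = insert-total t F in -, i ∷ b

  build-below : ∀ {x T F} → All (x ⊲_) T → Build R C T F → All (x ⊲_) F
  build-below []      []      = []
  build-below (q ∷ Q) (i ∷ b) = insert-below (build-below Q b) q i

  build-composition : ∀ {T F} → Semistandard R C T → Build R C T F → Composition R C F
  build-composition _               []      = [] , []
  build-composition (k ∷ K , p ∷ P) (i ∷ b) =
    insert-composition k (build-composition (K , P) b) (build-below p b) i

  build-injective : ∀ {T₁ T₂ F} → Semistandard R C T₁ → Semistandard R C T₂ →
                    Build R C T₁ F → Build R C T₂ F → T₁ ≡ T₂
  build-injective _ _ [] [] = refl
  build-injective (_ ∷ K₁ , _ ∷ P₁) (_ ∷ K₂ , _ ∷ P₂) (i₁ ∷ b₁) (i₂ ∷ b₂)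
    with refl , refl ← insert-injective (proj₁ (build-composition (K₁ , P₁) b₁))
                                        (proj₁ (build-composition (K₂ , P₂) b₂)) i₁ i₂
    with refl ← build-injective (K₁ , P₁) (K₂ , P₂) b₁ b₂ = refl

  build-det : ∀ {T F₁ F₂} → Build R C T F₁ → Build R C T F₂ → F₁ ≡ F₂
  build-det []        []        = refl
  build-det (i₁ ∷ b₁) (i₂ ∷ b₂)
    with refl ← build-det b₁ b₂
    with refl , refl ← insert-det i₁ i₂ = refl

  insert-length : ∀ {t F t′ F′} → Insert R C t F t′ F′ → length F ≡ length F′
  insert-length []      = refl
  insert-length (_ ∷ i) = cong suc (insert-length i)

  -- Undoing an insertion yields rows that are not a subterm of `F`, hence the recursion on the
  -- number of rows. The last component compares the row just removed with the rows recovered from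
  -- the remainder.
  build-surjective : ∀ n {F} → length F ≡ n → Composition R C F →
    ∃ λ T → Build R C T F × Semistandard R C T × (∀ {x} → All (x ⊲_) F → All (x ⊲_) T)
  build-surjective _       {[]}     _ _ = [] , [] , ([] , []) , λ _ → []
  build-surjective (suc n) {_ ∷ F′} e V =
    let t , F , i , kt , (K , P) , Q , _ = insert-surjective V
        T , b , (K′ , P′) , below =
          build-surjective n (trans (insert-length i) (ℕ.suc-injective e)) (K , P)
    in t ∷ T , i ∷ b , (kt ∷ K′ , below Q ∷ P′)
     , λ X → case insert-below⁻ K X i of λ { (x ∷ X′) → x ∷ below X′ }

  -- Invariance of the letters and of the row lengths

  swap-↭ : ∀ {u us ts us′ ts′} → Swap R C u us ts us′ ts′ → us ++ ts ↭ us′ ++ ts′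
  swap-↭ {us = us} end = ↭-reflexive (++-identityʳ us)
  swap-↭ {us = us} {t ∷ ts} (cross _) = ↭.++-comm us (t ∷ ts)
  swap-↭ (stop _) = ↭-refl
  swap-↭ (keep {t = t} {v} {us} {ts} {us′} {ts′} _ s) = prep v (begin
    us ++ t ∷ ts    ↭⟨ ↭.shift t us ts ⟩
    t ∷ us ++ ts    ↭⟨ prep t (swap-↭ s) ⟩
    t ∷ us′ ++ ts′  ↭⟨ ↭.shift t us′ ts′ ⟨
    us′ ++ t ∷ ts′  ∎)
    where open PermutationReasoning

  -- Both tails follow a common column, so an exchange of tails trades the lengths of the whole
  -- rows.
  swap-lengths : ∀ {u us ts us′ ts′} → Swap R C u us ts us′ ts′ →
    (length us ≡ length us′ × length ts ≡ length ts′) ⊎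
    (length us ≡ length ts′ × length ts ≡ length us′)
  swap-lengths end        = inj₂ (refl , refl)
  swap-lengths (cross _)  = inj₂ (refl , refl)
  swap-lengths (stop _)   = inj₁ (refl , refl)
  swap-lengths (keep _ s) with swap-lengths s
  ... | inj₁ (p , q) = inj₁ (cong suc p , cong suc q)
  ... | inj₂ (p , q) = inj₂ (cong suc p , cong suc q)

  swapRows-entries : ∀ {f t f′ t′} → SwapRows R C f t f′ t′ →
                     toList t ++ toList f ↭ toList t′ ++ toList f′
  swapRows-entries (rows {u} {us} {t} {ts} {us′} {ts′} s) = prep t (begin
    ts ++ u ∷ us    ↭⟨ ↭.++-comm ts (u ∷ us) ⟩
    u ∷ us ++ ts    ↭⟨ prep u (swap-↭ s) ⟩
    u ∷ us′ ++ ts′  ↭⟨ ↭.++-comm (u ∷ us′) ts′ ⟩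
    ts′ ++ u ∷ us′  ∎)
    where open PermutationReasoning

  swapRows-lengths : ∀ {f t f′ t′ ns} → SwapRows R C f t f′ t′ →
    List⁺.length t ∷ List⁺.length f ∷ ns ↭ List⁺.length t′ ∷ List⁺.length f′ ∷ ns
  swapRows-lengths (rows s) with swap-lengths s
  ... | inj₁ (p , q) = ↭-reflexive (cong₂ (λ a b → suc a ∷ suc b ∷ _) q p)
  ... | inj₂ (p , q) = ↭-trans (↭-reflexive (cong₂ (λ a b → suc a ∷ suc b ∷ _) q p))
                               (swap _ _ ↭-refl)

entries : {A : Set} → Tableau A → List A
entries = concatMap toList

shape : {A : Set} → Tableau A → List ℕ
shape = map List⁺.length

module _ {A : Set} {R C : Rel A 0ℓ} (RC : Complementary R C) where

  insert-entries : ∀ {t F t′ F′} → Insert R C t F t′ F′ →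
                   entries (t ∷ F) ↭ entries (t′ ∷ F′)
  insert-entries []      = ↭-refl
  insert-entries {t} {f ∷ F} {t″} {f′ ∷ F′} (_∷_ {t′ = t′} s i) = begin
    toList t ++ toList f ++ entries F     ↭⟨ ↭.shifts (toList t) (toList f) ⟩
    toList f ++ toList t ++ entries F     ↭⟨ ↭.++⁺ˡ (toList f) (insert-entries i) ⟩
    toList f ++ toList t′ ++ entries F′   ↭⟨ ↭.shifts (toList f) (toList t′) ⟩
    toList t′ ++ toList f ++ entries F′   ↭⟨ ↭.++-assoc (toList t′) (toList f) _ ⟨
    (toList t′ ++ toList f) ++ entries F′ ↭⟨ ↭.++⁺ʳ (entries F′) (swapRows-entries RC s) ⟩
    (toList t″ ++ toList f′) ++ entries F′ ↭⟨ ↭.++-assoc (toList t″) (toList f′) _ ⟩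
    toList t″ ++ toList f′ ++ entries F′  ∎
    where open PermutationReasoning

  insert-shape : ∀ {t F t′ F′} → Insert R C t F t′ F′ → shape (t ∷ F) ↭ shape (t′ ∷ F′)
  insert-shape []      = ↭-refl
  insert-shape (s ∷ i) =
    ↭-trans (swap _ _ ↭-refl)
    (↭-trans (prep _ (insert-shape i))
    (↭-trans (swap _ _ ↭-refl) (swapRows-lengths RC s)))

  build-entries : ∀ {T F} → Build R C T F → entries T ↭ entries F
  build-entries []      = ↭-refl
  build-entries {t ∷ _} (i ∷ b) =
    ↭-trans (↭.++⁺ˡ (toList t) (build-entries b)) (insert-entries i)

  build-shape : ∀ {T F} → Build R C T F → shape T ↭ shape F
  build-shape []      = ↭-refl
  build-shape (i ∷ b) = ↭-trans (prep _ (build-shape b)) (insert-shape i)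

-- Transposition

addRow : {A : Set} → List A → Tableau A → Tableau A
addRow []       cs       = cs
addRow (x ∷ xs) []       = (x ∷ []) ∷ addRow xs []
addRow (x ∷ xs) (c ∷ cs) = (x ∷⁺ c) ∷ addRow xs cs

transpose : {A : Set} → Tableau A → Tableau A
transpose []      = []
transpose (t ∷ T) = addRow (toList t) (transpose T)

-- This is the change in the column lengths when a bottom row of that many cells is adjoined.
growParts : ℕ → List ℕ → List ℕ
growParts 0       ns       = ns
growParts (suc p) []       = 1 ∷ growParts p []
growParts (suc p) (n ∷ ns) = suc n ∷ growParts p ns

module _ {A : Set} where

  private variable
    xs ys : List A
    c d   : List⁺ A
    cs ds : Tableau A
    R C   : Rel A 0ℓ

  -- The heads of the columns form the row above `xs`, so this is `◁` between adjacent rows, read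
  -- off the columns.
  Fits : Rel A 0ℓ → List A → Tableau A → Set
  Fits C xs cs = Prefix (flip C) (map List⁺.head cs) xs

  addRow-heads : Fits C xs cs → map List⁺.head (addRow xs cs) ≡ xs
  addRow-heads {xs = []}     {[]}     _       = refl
  addRow-heads {C = C} {x ∷ xs} {[]}  _       = cong (x ∷_) (addRow-heads {C = C} [])
  addRow-heads {xs = x ∷ xs} {_ ∷ _} (_ ∷ p) = cong (x ∷_) (addRow-heads p)

  addRow-RowOK : Fits C xs cs → All (RowOK C C) cs → All (RowOK C C) (addRow xs cs)
  addRow-RowOK {xs = []}             _       K       = K
  addRow-RowOK {C = C} {xs = x ∷ xs} {[]}    _       []      =
    [-] ∷ addRow-RowOK {C = C} [] []
  addRow-RowOK {xs = x ∷ xs} {_ ∷ _} (c ∷ p) (k ∷ K) = (c ∷ k) ∷ addRow-RowOK p K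

  addRow-after : ∀ {x us} → All (R x) xs → Fits C xs cs →
                 All (λ d → Prefix (flip R) (toList d) us) cs →
                 All (λ d → Prefix (flip R) (toList d) (x ∷ us)) (addRow xs cs)
  addRow-after {cs = []}        []      _       _       = []
  addRow-after {C = C} {cs = []} (r ∷ rs) _      _       =
    (r ∷ []) ∷ addRow-after {C = C} rs [] []
  addRow-after {cs = _ ∷ _}     (r ∷ rs) (_ ∷ p) (q ∷ Q) = (r ∷ q) ∷ addRow-after rs p Q

  addRow-◁ : AllPairs R xs → Fits C xs cs → AllPairs (_◁_ C R) cs →
             AllPairs (_◁_ C R) (addRow xs cs)
  addRow-◁ []       _       Q       = Q
  addRow-◁ {C = C} {cs = []}    (r ∷ rs) _       _       =
    addRow-after {C = C} r [] [] ∷ addRow-◁ {C = C} rs [] []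
  addRow-◁ {cs = _ ∷ _} (r ∷ rs) (_ ∷ p) (q ∷ Q) = addRow-after r p q ∷ addRow-◁ rs p Q

  -- The column heads return the added row. Below those heads a one-cell column is new and a longer
  -- one was extended, which returns the old columns.
  addRow-injective : Fits C xs cs → Fits C ys ds → addRow xs cs ≡ addRow ys ds →
                     xs ≡ ys × cs ≡ ds
  addRow-injective {C = C} {xs} {cs} {ys} {ds} p q e = xs≡ys , tails p q e
    where
    xs≡ys : xs ≡ ys
    xs≡ys = trans (sym (addRow-heads p)) (trans (cong (map List⁺.head) e) (addRow-heads q))

    tails : ∀ {xs ys cs ds} → Fits C xs cs → Fits C ys ds → addRow xs cs ≡ addRow ys ds → cs ≡ ds
    tails {[]}    {[]}    {[]}    {[]}    _ _ _ = refl
    tails {[]}    {_ ∷ _} {[]}    {[]}    _ _ ()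
    tails {[]}    {_ ∷ _} {[]}    {_ ∷ _} _ _ ()
    tails {_ ∷ _} {[]}    {[]}    {[]}    _ _ ()
    tails {_ ∷ _} {[]}    {_ ∷ _} {[]}    _ _ ()
    tails {_ ∷ _} {_ ∷ _} {[]}    {[]}    _ _ _ = refl
    tails {_ ∷ _} {_ ∷ _} {[]}    {_ ∷ _} _ _ e with () ← proj₁ (∷-injective e)
    tails {_ ∷ _} {_ ∷ _} {_ ∷ _} {[]}    _ _ e with () ← proj₁ (∷-injective e)
    tails {_ ∷ _} {_ ∷ _} {_ ∷ _} {_ ∷ _} (_ ∷ p) (_ ∷ q) e
      with refl , e′ ← ∷-injective e = cong (_ ∷_) (tails p q e′)

  addRow-entries : ∀ (xs : List A) cs → Fits C xs cs → entries (addRow xs cs) ↭ xs ++ entries cs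
  addRow-entries []       _        _       = ↭-refl
  addRow-entries {C} (x ∷ xs) []       _       = prep x (addRow-entries {C} xs [] [])
  addRow-entries (x ∷ xs) (c ∷ cs) (_ ∷ p) = prep x
    (↭-trans (↭.++⁺ˡ (toList c) (addRow-entries xs cs p)) (↭.shifts (toList c) xs))

  addRow-shape : ∀ (xs : List A) cs → shape (addRow xs cs) ≡ growParts (length xs) (shape cs)
  addRow-shape []       cs       = refl
  addRow-shape (x ∷ xs) []       = cong (1 ∷_) (addRow-shape xs [])
  addRow-shape (x ∷ xs) (c ∷ cs) = cong (_ ∷_) (addRow-shape xs cs)

module _ {A : Set} {R C : Rel A 0ℓ} (RC : Complementary R C) where

  open Complementary RC

  transpose-fits : ∀ {t : List⁺ A} {T} → Semistandard R C (t ∷ T) →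
                   Fits C (toList t) (transpose T)
  transpose-fits {T = []}    _ = []
  transpose-fits {t} {u ∷ T} (_ ∷ K , (p ∷ _) ∷ P) =
    subst (λ us → Prefix (flip C) us (toList t))
          (sym (addRow-heads (transpose-fits {u} (K , P)))) p

  transpose-semistandard : ∀ {T} → Semistandard R C T → Semistandard C R (transpose T)
  transpose-semistandard {[]}    _ = [] , []
  transpose-semistandard {t ∷ T} ss@(k ∷ K , p ∷ P) =
    let K′ , P′ = transpose-semistandard (K , P)
        fits    = transpose-fits ss
    in addRow-RowOK fits K′ , addRow-◁ (Linked⇒AllPairs R-trans k) fits P′

  transpose-injective : ∀ {T U} → Semistandard R C T → Semistandard R C U →
                        transpose T ≡ transpose U → T ≡ U
  transpose-injective {[]}    {[]}    _ _ _ = refl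
  transpose-injective {[]}    {u ∷ U} s s′ e
    with () ← proj₁ (addRow-injective {C = C} {xs = []} [] (transpose-fits s′) e)
  transpose-injective {t ∷ T} {[]}    s s′ e
    with () ← proj₁ (addRow-injective {C = C} {ys = []} (transpose-fits s) [] e)
  transpose-injective {t ∷ T} {u ∷ U} s@(_ ∷ K , _ ∷ P) s′@(_ ∷ K′ , _ ∷ P′) e
    with refl , e′ ← addRow-injective (transpose-fits s) (transpose-fits s′) e =
    cong (t ∷_) (transpose-injective (K , P) (K′ , P′) e′)

  transpose-entries : ∀ {T} → Semistandard R C T → entries (transpose T) ↭ entries T
  transpose-entries {[]}    _ = ↭-refl
  transpose-entries {t ∷ T} s@(_ ∷ K , _ ∷ P) =
    ↭-trans (addRow-entries (toList t) (transpose T) (transpose-fits s))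
            (↭.++⁺ˡ (toList t) (transpose-entries (K , P)))

transpose-shape : {A : Set} (T : Tableau A) →
                  shape (transpose T) ≡ foldr growParts [] (shape T)
transpose-shape []            = refl
transpose-shape ((x ∷ xs) ∷ T) =
  trans (addRow-shape (x ∷ xs) (transpose T)) (cong (growParts _) (transpose-shape T))

-- Conjugate partitions

maximum : List ℕ → ℕ
maximum = foldr _⊔_ 0

countAbove : List ℕ → ℕ → ℕ
countAbove ns j = length (filterᵇ (λ p → suc j ≤ᵇ p) ns)

conjugate-applyUpTo : ∀ ns → conjugate ns ≡ applyUpTo (countAbove ns) (maximum ns)
conjugate-applyUpTo ns = map-upTo (countAbove ns) (maximum ns)

countAbove-< : ∀ {p j} ns → j < p → countAbove (p ∷ ns) j ≡ suc (countAbove ns j)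
countAbove-< {p} {j} ns j<p with suc j ≤ᵇ p | ℕ.≤⇒≤ᵇ j<p
... | true | _ = refl

countAbove-≥ : ∀ {p j} ns → p ≤ j → countAbove (p ∷ ns) j ≡ countAbove ns j
countAbove-≥ {p} {j} ns p≤j with suc j ≤ᵇ p | ℕ.≤ᵇ⇒≤ (suc j) p
... | false | _ = refl
... | true  | f = ⊥-elim (ℕ.≤⇒≯ p≤j (f tt))

-- `suc (suc j) ≤ᵇ suc p` computes to `suc j ≤ᵇ p`, so one case split settles both sides.
countAbove-suc : ∀ {p j} ns ms → countAbove ms (suc j) ≡ countAbove ns j →
                 countAbove (suc p ∷ ms) (suc j) ≡ countAbove (p ∷ ns) j
countAbove-suc {p} {j} ns ms e with suc j ≤ᵇ p
... | true  = cong suc e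
... | false = e

countAbove-maximum : ∀ ns {j} → maximum ns ≤ j → countAbove ns j ≡ 0
countAbove-maximum []       _ = refl
countAbove-maximum (p ∷ ns) {j} m≤j =
  trans (countAbove-≥ ns (≤-trans (ℕ.m≤m⊔n p (maximum ns)) m≤j))
          (countAbove-maximum ns (≤-trans (ℕ.m≤n⊔m p (maximum ns)) m≤j))

countAbove-antitone : ∀ ns j → countAbove ns j ≥ countAbove ns (suc j)
countAbove-antitone []       j = z≤n
countAbove-antitone (p ∷ ns) j with suc (suc j) ℕ.≤? p | suc j ℕ.≤? p
... | yes a | _ rewrite countAbove-< ns a | countAbove-< ns (ℕ.<-trans (ℕ.n<1+n j) a) =
  s≤s (countAbove-antitone ns j)
... | no a | yes b rewrite countAbove-≥ ns (s≤s⁻¹ (ℕ.≰⇒> a)) | countAbove-< ns b =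
  ℕ.m≤n⇒m≤1+n (countAbove-antitone ns j)
... | no a | no b
  rewrite countAbove-≥ ns (s≤s⁻¹ (ℕ.≰⇒> a)) | countAbove-≥ ns (s≤s⁻¹ (ℕ.≰⇒> b)) =
  countAbove-antitone ns j

countAbove-positive : ∀ {ns} → All (1 ≤_) ns → countAbove ns 0 ≡ length ns
countAbove-positive                 []      = refl
countAbove-positive {ns = _ ∷ ns} (1≤p ∷ ps) =
  trans (countAbove-< ns 1≤p) (cong suc (countAbove-positive ps))

applyUpTo-cong : ∀ {f g : ℕ → ℕ} n → (∀ {j} → j < n → f j ≡ g j) → applyUpTo f n ≡ applyUpTo g n
applyUpTo-cong zero    e = refl
applyUpTo-cong (suc n) e = cong₂ _∷_ (e (s≤s z≤n)) (applyUpTo-cong n (λ j<n → e (s≤s j<n)))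

-- As `f` vanishes from `m` on, the list may be thought of as padded with zeros up to length `p`; a
-- new part `1` is then the successor of such a zero.
growParts-applyUpTo : ∀ (f : ℕ → ℕ) {m p} → m ≤ p → (∀ {j} → m ≤ j → f j ≡ 0) →
                      growParts p (applyUpTo f m) ≡ applyUpTo (suc ∘ f) p
growParts-applyUpTo f {p = zero}  z≤n       e = refl
growParts-applyUpTo f {p = suc p} z≤n       e =
  cong₂ _∷_ (cong suc (sym (e z≤n))) (growParts-applyUpTo (f ∘ suc) z≤n (λ _ → e z≤n))
growParts-applyUpTo f             (s≤s m≤p) e =
  cong (_ ∷_) (growParts-applyUpTo (f ∘ suc) m≤p (λ m≤j → e (s≤s m≤j)))

maximum-≤ : ∀ {p ns} → All (_≤ p) ns → maximum ns ≤ p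
maximum-≤ []       = z≤n
maximum-≤ (q ∷ qs) = ℕ.⊔-lub q (maximum-≤ qs)

conjugate-∷ : ∀ {p ns} → All (_≤ p) ns → conjugate (p ∷ ns) ≡ growParts p (conjugate ns)
conjugate-∷ {p} {ns} ns≤p = begin
  conjugate (p ∷ ns)
    ≡⟨ conjugate-applyUpTo (p ∷ ns) ⟩
  applyUpTo (countAbove (p ∷ ns)) (p ⊔ maximum ns)
    ≡⟨ cong (applyUpTo _) (ℕ.m≥n⇒m⊔n≡m (maximum-≤ ns≤p)) ⟩
  applyUpTo (countAbove (p ∷ ns)) p
    ≡⟨ applyUpTo-cong p (countAbove-< ns) ⟩
  applyUpTo (suc ∘ countAbove ns) p
    ≡⟨ growParts-applyUpTo (countAbove ns) (maximum-≤ ns≤p) (countAbove-maximum ns) ⟨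
  growParts p (applyUpTo (countAbove ns) (maximum ns))
    ≡⟨ cong (growParts p) (conjugate-applyUpTo ns) ⟨
  growParts p (conjugate ns) ∎
  where open ≡-Reasoning

IsPartition-∷⁻ : ∀ {p ns} → IsPartition (p ∷ ns) → 1 ≤ p × All (_≤ p) ns × IsPartition ns
IsPartition-∷⁻ (1≤p ∷ pos , desc) =
  1≤p , AllPairs.head (Linked⇒AllPairs (λ a b → ≤-trans b a) desc) , pos , Linked.tail desc

conjugate-foldr : ∀ {ns} → IsPartition ns → conjugate ns ≡ foldr growParts [] ns
conjugate-foldr {[]}     _    = refl
conjugate-foldr {p ∷ ns} part =
  let _ , ns≤p , part′ = IsPartition-∷⁻ part
  in trans (conjugate-∷ ns≤p) (cong (growParts p) (conjugate-foldr part′))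

growParts-positive : ∀ p {ns} → All (1 ≤_) ns → All (1 ≤_) (growParts p ns)
growParts-positive zero    pos       = pos
growParts-positive (suc p) []        = s≤s z≤n ∷ growParts-positive p []
growParts-positive (suc p) (_ ∷ pos) = s≤s z≤n ∷ growParts-positive p pos

conjugate-IsPartition : ∀ {ns} → IsPartition ns → IsPartition (conjugate ns)
conjugate-IsPartition {ns} part =
  subst (All (1 ≤_)) (sym (conjugate-foldr part)) (positive ns) ,
  subst (Linked _≥_) (sym (conjugate-applyUpTo ns))
        (Linked.applyUpTo⁺₂ (countAbove ns) (maximum ns) (countAbove-antitone ns))
  where
  positive : ∀ ns → All (1 ≤_) (foldr growParts [] ns)
  positive []       = []
  positive (p ∷ ns) = growParts-positive p (positive ns)

length-growParts : ∀ p ns → length ns ≤ p → length (growParts p ns) ≡ p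
length-growParts zero    []       _        = refl
length-growParts (suc p) []       _        = cong suc (length-growParts p [] z≤n)
length-growParts (suc p) (n ∷ ns) (s≤s le) = cong suc (length-growParts p ns le)

maximum-growParts : ∀ p ns → length ns ≤ p → 1 ≤ p → maximum (growParts p ns) ≡ suc (maximum ns)
maximum-growParts (suc zero)    []           _        _ = refl
maximum-growParts (suc (suc p)) []           _        _ =
  cong (1 ⊔_) (maximum-growParts (suc p) [] z≤n (s≤s z≤n))
maximum-growParts (suc zero)    (n ∷ [])     _        _ = cong suc (sym (ℕ.⊔-identityʳ n))
maximum-growParts (suc zero)    (_ ∷ _ ∷ _)  (s≤s ()) _
maximum-growParts (suc (suc p)) (n ∷ ns)     (s≤s le) _ =
  cong (suc n ⊔_) (maximum-growParts (suc p) ns le (s≤s z≤n))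

countAbove-growParts : ∀ p ns j → length ns ≤ p → countAbove (growParts p ns) (suc j) ≡ countAbove ns j
countAbove-growParts zero    []       j _        = refl
countAbove-growParts (suc p) []       j _        = countAbove-growParts p [] j z≤n
countAbove-growParts (suc p) (n ∷ ns) j (s≤s le) =
  countAbove-suc {n} ns (growParts p ns) (countAbove-growParts p ns j le)

-- All `p` parts of the grown list are positive, which gives the leading part; the remaining
-- thresholds drop by one. For `p = 0` the conjugate would be empty, without a leading `0`.
conjugate-growParts : ∀ {p ns} → 1 ≤ p → length ns ≤ p → All (1 ≤_) ns →
                      conjugate (growParts p ns) ≡ p ∷ conjugate ns
conjugate-growParts {p} {ns} 1≤p le pos = begin
  conjugate (growParts p ns)
    ≡⟨ conjugate-applyUpTo (growParts p ns) ⟩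
  applyUpTo (countAbove (growParts p ns)) (maximum (growParts p ns))
    ≡⟨ cong (applyUpTo _) (maximum-growParts p ns le 1≤p) ⟩
  countAbove (growParts p ns) 0 ∷ applyUpTo (countAbove (growParts p ns) ∘ suc) (maximum ns)
    ≡⟨ cong₂ _∷_ (trans (countAbove-positive (growParts-positive p pos)) (length-growParts p ns le))
                 (applyUpTo-cong (maximum ns) (λ {j} _ → countAbove-growParts p ns j le)) ⟩
  p ∷ applyUpTo (countAbove ns) (maximum ns)
    ≡⟨ cong (p ∷_) (conjugate-applyUpTo ns) ⟨
  p ∷ conjugate ns ∎
  where open ≡-Reasoning

conjugate-involutive : ∀ {ns} → IsPartition ns → conjugate (conjugate ns) ≡ ns
conjugate-involutive {[]}     _    = refl
conjugate-involutive {p ∷ ns} part with 1≤p , ns≤p , part′ ← IsPartition-∷⁻ part = begin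
  conjugate (conjugate (p ∷ ns))           ≡⟨ cong conjugate (conjugate-∷ ns≤p) ⟩
  conjugate (growParts p (conjugate ns))   ≡⟨ conjugate-growParts 1≤p len (proj₁ (conjugate-IsPartition part′)) ⟩
  p ∷ conjugate (conjugate ns)             ≡⟨ cong (p ∷_) (conjugate-involutive part′) ⟩
  p ∷ ns                                   ∎
  where
  open ≡-Reasoning
  -- The number of parts of the conjugate is the largest part of `ns`.
  len : length (conjugate ns) ≤ p
  len = subst (_≤ p) (sym (trans (cong length (conjugate-applyUpTo ns))
                                   (length-applyUpTo (countAbove ns) (maximum ns))))
              (maximum-≤ ns≤p)

-- Sorting

insertDesc-↭ : ∀ x ns → insertDesc x ns ↭ x ∷ ns
insertDesc-↭ x []       = ↭-refl
insertDesc-↭ x (y ∷ ns) with y ≤ᵇ x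
... | true  = ↭-refl
... | false = ↭-trans (prep y (insertDesc-↭ x ns)) (swap y x ↭-refl)

sortDesc-↭ : ∀ ns → sortDesc ns ↭ ns
sortDesc-↭ []       = ↭-refl
sortDesc-↭ (n ∷ ns) = ↭-trans (insertDesc-↭ n (sortDesc ns)) (prep n (sortDesc-↭ ns))

insertDesc-Linked : ∀ x {ns} → Linked _≥_ ns → Linked _≥_ (insertDesc x ns)
insertDesc-Linked x {[]}     _  = [-]
insertDesc-Linked x {y ∷ ns} ns↘ with y ≤ᵇ x in e
... | true  = ℕ.≤ᵇ⇒≤ y x (subst T (sym e) tt) ∷ ns↘
... | false = below y≥x ns↘
  where
  y≥x : y ≥ x
  y≥x = ℕ.≮⇒≥ λ y<x → subst T e (ℕ.≤⇒≤ᵇ (ℕ.<⇒≤ y<x))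

  below : ∀ {y ns} → y ≥ x → Linked _≥_ (y ∷ ns) → Linked _≥_ (y ∷ insertDesc x ns)
  below                y≥x [-] = y≥x ∷ [-]
  below {ns = z ∷ _} y≥x (y≥z ∷ ns↘) with z ≤ᵇ x | insertDesc-Linked x ns↘
  ... | true  | l = y≥x ∷ l
  ... | false | l = y≥z ∷ l

sortDesc-Linked : ∀ ns → Linked _≥_ (sortDesc ns)
sortDesc-Linked []       = []
sortDesc-Linked (n ∷ ns) = insertDesc-Linked n (sortDesc-Linked ns)

≥-totalOrder = Flip.totalOrder ℕ.≤-totalOrder

↘↭↘⇒≡ : ∀ {ms ns} → Linked _≥_ ms → Linked _≥_ ns → ms ↭ ns → ms ≡ ns
↘↭↘⇒≡ ms↘ ns↘ p = Pointwise-≡⇒≡ (↗↭↗⇒≋ ≥-totalOrder ms↘ ns↘ (↭⇒↭ₛ′ isEquivalence p))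

sortDesc-sorts : ∀ {ms ns} → Linked _≥_ ns → ms ↭ ns → sortDesc ms ≡ ns
sortDesc-sorts {ms} ns↘ p = ↘↭↘⇒≡ (sortDesc-Linked ms) ns↘ (↭-trans (sortDesc-↭ ms) p)

-- The two relations on letters and the triple test

strictOr⇔ : ∀ {x y} {P Q : Set} t → T x ⇔ P → T y ⇔ Q → (P → Q → ⊥) →
            T ((x ∨ y) ∧ not (t ∧ y)) ⇔ (P ⊎ (Q × t ≡ false))
strictOr⇔ {true}  {true}  _     x⇔ y⇔ ¬pq = ⊥-elim (¬pq (to x⇔ tt) (to y⇔ tt))
strictOr⇔ {true}  {false} true  x⇔ y⇔ ¬pq = mk⇔ (λ _ → inj₁ (to x⇔ tt)) _
strictOr⇔ {true}  {false} false x⇔ y⇔ ¬pq = mk⇔ (λ _ → inj₁ (to x⇔ tt)) _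
strictOr⇔ {false} {true}  true  x⇔ y⇔ ¬pq = mk⇔ (λ ()) λ { (inj₁ p) → from x⇔ p ; (inj₂ (_ , ())) }
strictOr⇔ {false} {true}  false x⇔ y⇔ ¬pq = mk⇔ (λ _ → inj₂ (to y⇔ tt , refl)) _
strictOr⇔ {false} {false} _     x⇔ y⇔ ¬pq = mk⇔ (λ ()) λ { (inj₁ p) → from x⇔ p ; (inj₂ (q , _)) → from y⇔ q }

implies⇔ : ∀ {x y} {P Q : Set} → T x ⇔ P → T y ⇔ Q → T (not x ∨ y) ⇔ (P → Q)
implies⇔ {true}  x⇔ y⇔ = mk⇔ (λ q _ → to y⇔ q) (λ f → from y⇔ (f (to x⇔ tt)))
implies⇔ {false} x⇔ y⇔ = mk⇔ (λ _ p → ⊥-elim (from x⇔ p)) _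

module _ {k l : ℕ} where

  -- The offset `k` places the primed letters after all unprimed ones.
  rank : Letter k l → ℕ
  rank (inj₁ i) = toℕ i
  rank (inj₂ j) = k + toℕ j

  rank-injective : ∀ {a b} → rank a ≡ rank b → a ≡ b
  rank-injective {inj₁ i} {inj₁ j} e = cong inj₁ (toℕ-injective e)
  rank-injective {inj₁ i} {inj₂ j} e =
    ⊥-elim (ℕ.<⇒≱ (toℕ<n i) (subst (k ≤_) (sym e) (ℕ.m≤m+n k _)))
  rank-injective {inj₂ i} {inj₁ j} e =
    ⊥-elim (ℕ.<⇒≱ (toℕ<n j) (subst (k ≤_) e (ℕ.m≤m+n k _)))
  rank-injective {inj₂ i} {inj₂ j} e = cong inj₂ (toℕ-injective (ℕ.+-cancelˡ-≡ k _ _ e))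

  ltL⇔ : ∀ a b → T (ltL a b) ⇔ (rank a < rank b)
  ltL⇔ (inj₁ i) (inj₁ j) = mk⇔ (ℕ.<ᵇ⇒< _ _) ℕ.<⇒<ᵇ
  ltL⇔ (inj₁ i) (inj₂ j) = mk⇔ (λ _ → ℕ.<-≤-trans (toℕ<n i) (ℕ.m≤m+n k _)) _
  ltL⇔ (inj₂ i) (inj₁ j) =
    mk⇔ ⊥-elim λ k+i<j → ℕ.<⇒≱ (ℕ.<-trans k+i<j (toℕ<n j)) (ℕ.m≤m+n k _)
  ltL⇔ (inj₂ i) (inj₂ j) =
    mk⇔ (ℕ.+-monoʳ-< k ∘ ℕ.<ᵇ⇒< _ _) (ℕ.<⇒<ᵇ ∘ ℕ.+-cancelˡ-< k _ _)

  eqL⇔ : (a b : Letter k l) → T (eqL a b) ⇔ (a ≡ b)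
  eqL⇔ (inj₁ i) (inj₁ j) =
    mk⇔ (cong inj₁ ∘ toℕ-injective ∘ ℕ.≡ᵇ⇒≡ _ _) λ { refl → ℕ.≡⇒≡ᵇ (toℕ i) _ refl }
  eqL⇔ (inj₁ _) (inj₂ _) = mk⇔ (λ ()) (λ ())
  eqL⇔ (inj₂ _) (inj₁ _) = mk⇔ (λ ()) (λ ())
  eqL⇔ (inj₂ i) (inj₂ j) =
    mk⇔ (cong inj₂ ∘ toℕ-injective ∘ ℕ.≡ᵇ⇒≡ _ _) λ { refl → ℕ.≡⇒≡ᵇ (toℕ i) _ refl }

  Increasing : (Letter k l → Bool) → Rel (Letter k l) 0ℓ
  Increasing s a b = rank a < rank b ⊎ (a ≡ b × s a ≡ false)

  Increasing⇔ : ∀ s a b → T (leL a b ∧ not (s a ∧ eqL a b)) ⇔ Increasing s a b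
  Increasing⇔ s a b =
    strictOr⇔ (s a) (ltL⇔ a b) (eqL⇔ a b) (λ p e → ℕ.<-irrefl (cong rank e) p)

  Increasing-trans : ∀ s {a b c} → Increasing s a b → Increasing s b c → Increasing s a c
  Increasing-trans s (inj₁ p)          (inj₁ q)          = inj₁ (ℕ.<-trans p q)
  Increasing-trans s (inj₁ p)          (inj₂ (refl , _)) = inj₁ p
  Increasing-trans s (inj₂ (refl , _)) q                 = q

  -- Distinct letters are decided by the order, equal ones by `s`: exactly one of the two relations
  -- admits a repetition of a given letter.
  complementary : ∀ s → Complementary (Increasing s) (Increasing (not ∘ s))
  complementary s = record
    { compare = compare
    ; exclude = exclude
    ; R-trans = Increasing-trans s
    ; C-trans = Increasing-trans (not ∘ s)
    }
    where
    compare : ∀ a b → Increasing s a b ⊎ Increasing (not ∘ s) b a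
    compare a b with ℕ.<-cmp (rank a) (rank b)
    ... | tri< a<b _ _ = inj₁ (inj₁ a<b)
    ... | tri> _ _ b<a = inj₂ (inj₁ b<a)
    ... | tri≈ _ e _ with rank-injective {a} {b} e | s a in sa
    ...   | refl | false = inj₁ (inj₂ (refl , refl))
    ...   | refl | true  = inj₂ (inj₂ (refl , cong not sa))

    exclude : ∀ {a b} → Increasing s a b → Increasing (not ∘ s) b a → ⊥
    exclude (inj₁ p)          (inj₁ q)          = ℕ.<-asym p q
    exclude (inj₁ p)          (inj₂ (refl , _)) = ℕ.<-irrefl refl p
    exclude (inj₂ (refl , _)) (inj₁ q)          = ℕ.<-irrefl refl q
    exclude (inj₂ (refl , e)) (inj₂ (_ , f)) rewrite e with () ← f

  leL⇔ : (a b : Letter k l) → T (leL a b) ⇔ (rank a < rank b ⊎ a ≡ b)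
  leL⇔ a b = mk⇔ ⇒ ⇐
    where
    ⇒ : T (leL a b) → rank a < rank b ⊎ a ≡ b
    ⇒ p with to (T-∨ {ltL a b}) p
    ... | inj₁ q = inj₁ (to (ltL⇔ a b) q)
    ... | inj₂ q = inj₂ (to (eqL⇔ a b) q)

    ⇐ : rank a < rank b ⊎ a ≡ b → T (leL a b)
    ⇐ (inj₁ q) = from (T-∨ {ltL a b}) (inj₁ (from (ltL⇔ a b) q))
    ⇐ (inj₂ q) = from (T-∨ {ltL a b}) (inj₂ (from (eqL⇔ a b) q))

  strict⇔ : ∀ s {a b} → s b ≡ true → T (ltL a b) ⇔ Increasing s a b
  strict⇔ s {a} {b} sb = mk⇔ (inj₁ ∘ to (ltL⇔ a b)) λ where
    (inj₁ p)          → from (ltL⇔ a b) p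
    (inj₂ (refl , e)) → case trans (sym sb) e of λ ()

  weak⇔ : ∀ s {a b} → s b ≡ false → T (leL a b) ⇔ Increasing s a b
  weak⇔ s {a} {b} sb = mk⇔ ⇒ λ { (inj₁ p)       → from (leL⇔ a b) (inj₁ p)
                               ; (inj₂ (e , _)) → from (leL⇔ a b) (inj₂ e) }
    where
    ⇒ : T (leL a b) → Increasing s a b
    ⇒ p with to (leL⇔ a b) p
    ... | inj₁ q    = inj₁ q
    ... | inj₂ refl = inj₂ (refl , sb)

  tripleᵇ : (Letter k l → Bool) → Maybe (Letter k l) → Maybe (Letter k l) → Maybe (Letter k l) → Bool
  tripleᵇ s b c nothing  = true
  tripleᵇ s b c (just z) =
    if s z then (not (ltE b (just z)) ∨ leE c (just z))
           else (not (leE b (just z)) ∨ ltE c (just z))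

  tripleOK≡tripleᵇ : ∀ s (F : Filling k l) i j n →
    tripleOK s F i j n ≡ tripleᵇ s (hat F j n) (hat F j (suc n)) (hat F i (suc n))
  tripleOK≡tripleᵇ s F i j n with hat F i (suc n)
  ... | nothing = refl
  ... | just z  = refl

  tripleᵇ-∞ : ∀ s c z → T (tripleᵇ s nothing c z)
  tripleᵇ-∞ s c nothing  = tt
  tripleᵇ-∞ s c (just z) with s z
  ... | true  = tt
  ... | false = tt

  -- Conditions (a) and (b) merge here: `s z` decides which comparison is strict, and in both cases
  -- the premise is `R` and the conclusion `C`, each with `z` on the right.
  tripleᵇ-just⇔ : ∀ s u v z →
    T (tripleᵇ s (just u) (just v) (just z)) ⇔ (Increasing s u z → Increasing (not ∘ s) v z)
  tripleᵇ-just⇔ s u v z with s z in sz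
  ... | true  = implies⇔ (strict⇔ s sz) (weak⇔ (not ∘ s) (cong not sz))
  ... | false = implies⇔ (weak⇔ s sz) (strict⇔ (not ∘ s) (cong not sz))

  tripleᵇ-stop⇔ : ∀ s u z →
    T (tripleᵇ s (just u) nothing (just z)) ⇔ (Increasing s u z → ⊥)
  tripleᵇ-stop⇔ s u z with s z in sz
  ... | true  = implies⇔ (strict⇔ s sz) (mk⇔ id id)
  ... | false = implies⇔ (weak⇔ s sz) (mk⇔ id id)

-- Boolean tableau tests and composition tableaux

module _ {A : Set} where

  at-< : ∀ (xs : List A) {i x} → at xs i ≡ just x → i < length xs
  at-< (_ ∷ _)  {zero}  _ = s≤s z≤n
  at-< (_ ∷ xs) {suc i} e = s≤s (at-< xs e)

  at-All : ∀ {P : A → Set} {xs i x} → All P xs → at xs i ≡ just x → P x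
  at-All {i = zero}  (p ∷ _)  refl = p
  at-All {i = suc i} (_ ∷ ps) e    = at-All ps e

  All-at : ∀ {P : A → Set} xs → (∀ i {x} → at xs i ≡ just x → P x) → All P xs
  All-at []       f = []
  All-at (x ∷ xs) f = f 0 refl ∷ All-at xs (f ∘ suc)

  at-AllPairs : ∀ {R : Rel A 0ℓ} {xs i j x y} → AllPairs R xs → i < j →
                at xs i ≡ just x → at xs j ≡ just y → R x y
  at-AllPairs {i = zero}  {suc j} (r ∷ _)  _         refl e = at-All r e
  at-AllPairs {i = suc i} {suc j} (_ ∷ rs) (s≤s i<j) d    e = at-AllPairs rs i<j d e

  AllPairs-at : ∀ {R : Rel A 0ℓ} xs →
    (∀ i j {x y} → i < j → at xs i ≡ just x → at xs j ≡ just y → R x y) → AllPairs R xs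
  AllPairs-at []       f = []
  AllPairs-at (x ∷ xs) f =
    All-at xs (λ j → f 0 (suc j) (s≤s z≤n) refl) ∷
    AllPairs-at xs (λ i j i<j → f (suc i) (suc j) (s≤s i<j))

  at-total : ∀ (xs : List A) {i} → i < length xs → ∃ λ x → at xs i ≡ just x
  at-total (x ∷ _)  {zero}  _       = x , refl
  at-total (_ ∷ xs) {suc i} (s≤s p) = at-total xs p

  consecutive⇒Linked : ∀ (p : A → A → Bool) xs → T (consecutive p xs) → Linked (λ a b → T (p a b)) xs
  consecutive⇒Linked p []           _ = []
  consecutive⇒Linked p (x ∷ [])     _ = [-]
  consecutive⇒Linked p (x ∷ y ∷ xs) c =
    let q , c′ = to (T-∧ {p x y}) c in q ∷ consecutive⇒Linked p (y ∷ xs) c′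

  Linked⇒consecutive : ∀ (p : A → A → Bool) {xs} → Linked (λ a b → T (p a b)) xs → T (consecutive p xs)
  Linked⇒consecutive p []      = tt
  Linked⇒consecutive p [-]     = tt
  Linked⇒consecutive p (q ∷ l) = from T-∧ (q , Linked⇒consecutive p l)

  length-≤-maximum : ∀ (xss : List (List A)) → All (λ xs → length xs ≤ foldr _⊔_ 0 (map length xss)) xss
  length-≤-maximum []         = []
  length-≤-maximum (xs ∷ xss) =
    ℕ.m≤m⊔n (length xs) _ ∷
    All.map (λ le → ≤-trans le (ℕ.m≤n⊔m (length xs) _)) (length-≤-maximum xss)

module _ {k l : ℕ} (s : Letter k l → Bool) where

  private
    Row Column : Rel (Letter k l) 0ℓ
    Row    = Increasing s
    Column = Increasing (not ∘ s)

  hat-at : ∀ (F : Filling k l) {i} n {row} → at F i ≡ just row → hat F i n ≡ at row n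
  hat-at F {i} n e with at F i
  hat-at F n refl | just _ = refl

  -- The column is unbounded, unlike in `triplesOK`; past the end of the lower row the test is true,
  -- so the two ranges agree.
  Triples : Rel (List (Letter k l)) 0ℓ
  Triples lower upper = ∀ n → T (tripleᵇ s (at upper n) (at upper (suc n)) (at lower (suc n)))

  tripleOK-at : ∀ (F : Filling k l) {i j lower upper} n → at F i ≡ just lower → at F j ≡ just upper →
    tripleOK s F i j n ≡ tripleᵇ s (at upper n) (at upper (suc n)) (at lower (suc n))
  tripleOK-at F {i} {j} n p q =
    trans (tripleOK≡tripleᵇ s F i j n)
          (trans (cong₂ (λ b c → tripleᵇ s b c (hat F i (suc n))) (hat-at F n q) (hat-at F (suc n) q))
                   (cong (tripleᵇ s _ _) (hat-at F (suc n) p)))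

  triplesOK⇒ : ∀ (F : Filling k l) → T (triplesOK s F) → AllPairs Triples F
  triplesOK⇒ F ok = AllPairs-at F λ i j {lower} {upper} i<j p q n → beyond lower upper n λ n<m →
      subst T (tripleOK-at F n p q) (inside i j n i<j (at-< F p) (at-< F q) (bound p n<m))
    where
    m = foldr _⊔_ 0 (map length F)

    inside : ∀ i j n → i < j → i < length F → j < length F → n < m ∸ 1 → T (tripleOK s F i j n)
    inside i j n i<j i<r j<r n<m
      with All.lookup (All.all⁺ _ _ (All.lookup (All.all⁺ _ _ ok) (∈-upTo⁺ i<r))) (∈-upTo⁺ j<r)
    ... | t with i <ᵇ j | ℕ.<⇒<ᵇ i<j
    ...   | true | _ = All.lookup (All.all⁺ _ _ t) (∈-upTo⁺ n<m)

    beyond : ∀ lower upper n →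
      (suc n < length lower → T (tripleᵇ s (at upper n) (at upper (suc n)) (at lower (suc n)))) →
      T (tripleᵇ s (at upper n) (at upper (suc n)) (at lower (suc n)))
    beyond lower upper n f with at lower (suc n) in e
    ... | nothing = tt
    ... | just z  = f (at-< lower e)

    bound : ∀ {i n lower} → at F i ≡ just lower → suc n < length lower → n < m ∸ 1
    bound p n<m = ℕ.∸-monoˡ-≤ 1 (≤-trans n<m (at-All (length-≤-maximum F) p))

  triplesOK⇐ : ∀ (F : Filling k l) → AllPairs Triples F → T (triplesOK s F)
  triplesOK⇐ F ok =
    All.all⁻ _ (All.tabulate λ {i} i∈ → All.all⁻ _ (All.tabulate λ {j} j∈ → cell i j (∈-upTo⁻ i∈) (∈-upTo⁻ j∈)))
    where
    cell : ∀ i j → i < length F → j < length F →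
      T (if i <ᵇ j then and (map (λ n → tripleOK s F i j n) (upTo (foldr _⊔_ 0 (map length F) ∸ 1))) else true)
    cell i j i<r j<r with i <ᵇ j | ℕ.<ᵇ⇒< i j
    ... | false | _ = tt
    ... | true  | i<j =
      let lower , p = at-total F i<r ; upper , q = at-total F j<r
      in All.all⁻ _ {xs = upTo (foldr _⊔_ 0 (map length F) ∸ 1)} (All.tabulate λ {n} _ →
           subst T (sym (tripleOK-at F n p q)) (at-AllPairs ok (i<j tt) p q n))

  Triples⇒Dominates : ∀ u us t ts → Triples (t ∷ ts) (u ∷ us) → Dominates Row Column u us ts
  Triples⇒Dominates u us       t []       _ = end
  Triples⇒Dominates u []       t (z ∷ ts) f with Complementary.compare (complementary s) u z
  ... | inj₁ r = ⊥-elim (to (tripleᵇ-stop⇔ s u z) (f 0) r)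
  ... | inj₂ c = stop c
  Triples⇒Dominates u (v ∷ us) t (z ∷ ts) f =
    step (to (tripleᵇ-just⇔ s u v z) (f 0)) (Triples⇒Dominates v us z ts (f ∘ suc))

  Dominates⇒Triples : ∀ {u us ts} t → Dominates Row Column u us ts → Triples (t ∷ ts) (u ∷ us)
  Dominates⇒Triples t end n = tt
  Dominates⇒Triples {u} t (stop {t = z} c) zero =
    from (tripleᵇ-stop⇔ s u z) (λ r → Complementary.exclude (complementary s) r c)
  -- Past its end the upper row reads `∞`, which is never at most a letter, so the premise fails.
  Dominates⇒Triples {ts = _ ∷ ts} t (stop c) (suc n) = tripleᵇ-∞ s _ (at ts n)
  Dominates⇒Triples {u} t (step {v = v} {t = z} f d) zero = from (tripleᵇ-just⇔ s u v z) f
  Dominates⇒Triples t (step {t = z} f d) (suc n) = Dominates⇒Triples z d n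

  firstColumn-toList : ∀ (F : Tableau (Letter k l)) → firstColumn (map toList F) ≡ map List⁺.head F
  firstColumn-toList []            = refl
  firstColumn-toList ((_ ∷ _) ∷ F) = cong (_ ∷_) (firstColumn-toList F)

  tableauOK⇔ : ∀ F → T (tableauOK s (map toList F)) ⇔ Composition Row Column F
  tableauOK⇔ F = mk⇔ ⇒ ⇐
    where
    Fˡ = map toList F

    ⇒ : T (tableauOK s Fˡ) → Composition Row Column F
    ⇒ ok = let ok-rows , ok′ = to (T-∧ {rowsOK s Fˡ}) ok
               ok-col , ok-triples = to (T-∧ {columnOK s Fˡ}) ok′
               -- The column test compares neighbouring rows only; transitivity extends it to all
               -- pairs.
               heads = AllPairs.map⁻ (Linked⇒AllPairs (Increasing-trans (not ∘ s))
                         (Linked.map (λ {a} {b} → to (Increasing⇔ (not ∘ s) a b))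
                           (consecutive⇒Linked _ _ (subst (T ∘ consecutive _) (firstColumn-toList F) ok-col))))
           in All.map (Linked.map (λ {a} {b} → to (Increasing⇔ s a b)) ∘ consecutive⇒Linked _ _)
                      (All.map⁻ (All.all⁺ _ Fˡ ok-rows))
            , AllPairs.zipWith (λ { {t ∷ ts} {u ∷ us} (c , f) → c , Triples⇒Dominates u us t ts f })
                (heads , AllPairs.map⁻ (triplesOK⇒ Fˡ ok-triples))

    ⇐ : Composition Row Column F → T (tableauOK s Fˡ)
    ⇐ (K , P) = from T-∧
      ( All.all⁻ _ (All.map⁺ (All.map (Linked⇒consecutive _ ∘ Linked.map (λ {a} {b} → from (Increasing⇔ s a b))) K))
      , from T-∧
      ( subst (T ∘ consecutive _) (sym (firstColumn-toList F))
          (Linked⇒consecutive _ (Linked.map (λ {a} {b} → from (Increasing⇔ (not ∘ s) a b))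
            (AllPairs⇒Linked (AllPairs.map⁺ (AllPairs.map (⊑-head (complementary s)) P)))))
      , triplesOK⇐ Fˡ (AllPairs.map⁺ (AllPairs.map (λ { {t ∷ _} (_ , d) → Dominates⇒Triples t d }) P))))

-- Counting and enumeration

module _ {A B : Set} where

  -- A relation suffices because only the existence of partners is used. Each step deletes the
  -- partner of the head from `ys`; injectivity keeps it from being the partner of a later element.
  length-≤-injection : ∀ {xs : List A} {ys : List B} {_~_ : A → B → Set} → Unique xs →
    (∀ {x} → x ∈ xs → ∃ λ y → y ∈ ys × x ~ y) →
    (∀ {x x′ y} → x ~ y → x′ ~ y → x ≡ x′) → length xs ≤ length ys
  length-≤-injection {[]} _ _ _ = z≤n
  length-≤-injection {x ∷ xs} {_~_ = _~_} (x∉xs ∷ unique) image inj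
    with y , y∈ , x~y ← image (here refl)
    with as , bs , refl ← ∈-∃++ y∈ =
    subst (suc (length xs) ≤_) (sym (trans (length-++ as) (ℕ.+-suc _ _)))
      (s≤s (subst (length xs ≤_) (length-++ as) (length-≤-injection unique image′ inj)))
    where
    image′ : ∀ {x′} → x′ ∈ xs → ∃ λ y′ → y′ ∈ as ++ bs × x′ ~ y′
    image′ x′∈ with image (there x′∈)
    ... | y′ , y′∈ , x′~y′ with ∈-++⁻ as y′∈
    ...   | inj₁ ∈as = y′ , ∈-++⁺ˡ ∈as , x′~y′
    ...   | inj₂ (here refl) = ⊥-elim (All.lookup x∉xs x′∈ (inj x~y x′~y′))
    ...   | inj₂ (there ∈bs) = y′ , ∈-++⁺ʳ as ∈bs , x′~y′

  concatMap-unique : ∀ {f : A → List B} {key : B → A} {xs} → (∀ x → Unique (f x)) →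
    (∀ {x y} → y ∈ f x → key y ≡ x) → Unique xs → Unique (concatMap f xs)
  concatMap-unique {f} {xs = xs} unique key-f uxs =
    Unique.concat⁺ (All.map⁺ (All.universal unique xs))
      (AllPairs.map⁺ (AllPairs.map disjoint uxs))
    where
    disjoint : ∀ {x x′} → x ≢ x′ → Disjoint (f x) (f x′)
    disjoint x≢x′ (p , q) = x≢x′ (trans (sym (key-f p)) (key-f q))

  length-concatMap : ∀ (f : A → List B) xs → length (concatMap f xs) ≡ sum (map (length ∘ f) xs)
  length-concatMap f []       = refl
  length-concatMap f (x ∷ xs) = trans (length-++ (f x)) (cong (length (f x) +_) (length-concatMap f xs))

  concatMap-map : ∀ {C : Set} (f : A → B → C) xs ys →
                  concatMap (λ x → map (f x) ys) xs ≡ cartesianProductWith f xs ys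
  concatMap-map f []       ys = refl
  concatMap-map f (x ∷ xs) ys = cong (map (f x) ys ++_) (concatMap-map f xs ys)

  ∈-concatMap-map⁺ : ∀ {C : Set} (f : A → B → C) {xs ys x y} → x ∈ xs → y ∈ ys →
                     f x y ∈ concatMap (λ x → map (f x) ys) xs
  ∈-concatMap-map⁺ f {xs} {ys} x∈ y∈ =
    subst (_ ∈_) (sym (concatMap-map f xs ys)) (∈-cartesianProductWith⁺ f x∈ y∈)

  ∈-concatMap-map⁻ : ∀ {C : Set} (f : A → B → C) {xs ys z} → z ∈ concatMap (λ x → map (f x) ys) xs →
                     ∃₂ λ x y → x ∈ xs × y ∈ ys × z ≡ f x y
  ∈-concatMap-map⁻ f {xs} {ys} z∈ =
    ∈-cartesianProductWith⁻ f xs ys (subst (_ ∈_) (concatMap-map f xs ys) z∈)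

  concatMap-map-unique : ∀ {C : Set} (f : A → B → C) {xs ys} →
    (∀ {w x y z} → f w y ≡ f x z → w ≡ x × y ≡ z) → Unique xs → Unique ys →
    Unique (concatMap (λ x → map (f x) ys) xs)
  concatMap-map-unique f {xs} {ys} inj uxs uys =
    subst Unique (sym (concatMap-map f xs ys)) (Unique.cartesianProductWith⁺ f inj uxs uys)

module _ {A : Set} where

  words-length : ∀ {xs : List A} {w} r → w ∈ words xs r → length w ≡ r
  words-length zero    (here refl) = refl
  words-length {xs} (suc r) w∈
    with _ , _ , _ , w′∈ , refl ← ∈-concatMap-map⁻ _∷_ {xs} {words xs r} w∈ =
    cong suc (words-length r w′∈)

  ∈-words : ∀ {xs : List A} {w} → All (_∈ xs) w → w ∈ words xs (length w)
  ∈-words []       = here refl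
  ∈-words (x ∷ ws) = ∈-concatMap-map⁺ _∷_ x (∈-words ws)

  words-unique : ∀ {xs : List A} r → Unique xs → Unique (words xs r)
  words-unique zero    u = [] ∷ []
  words-unique (suc r) u = concatMap-map-unique _∷_ ∷-injective u (words-unique r u)

module _ {k l : ℕ} where

  ∈-allLetters : (a : Letter k l) → a ∈ allLetters k l
  ∈-allLetters (inj₁ i) = ∈-++⁺ˡ (∈-map⁺ inj₁ (∈-allFin i))
  ∈-allLetters (inj₂ j) = ∈-++⁺ʳ (map inj₁ (allFin k)) (∈-map⁺ inj₂ (∈-allFin j))

  allLetters-unique : Unique (allLetters k l)
  allLetters-unique = Unique.++⁺
    (Unique.map⁺ (λ { refl → refl }) (Unique.allFin⁺ k))
    (Unique.map⁺ (λ { refl → refl }) (Unique.allFin⁺ l))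
    disjoint
    where
    disjoint : Disjoint (map inj₁ (allFin k)) (map inj₂ (allFin l))
    disjoint (p , q) with _ , _ , refl ← ∈-map⁻ inj₁ p with _ , _ , () ← ∈-map⁻ inj₂ q

  fillings-shape : ∀ {F} α → F ∈ fillings k l α → map length F ≡ α
  fillings-shape []      (here refl) = refl
  fillings-shape (a ∷ α) F∈
    with _ , _ , w∈ , F′∈ , refl ←
      ∈-concatMap-map⁻ _∷_ {words (allLetters k l) a} {fillings k l α} F∈ =
    cong₂ _∷_ (words-length a w∈) (fillings-shape α F′∈)

  ∈-fillings : ∀ F → F ∈ fillings k l (map length F)
  ∈-fillings []      = here refl
  ∈-fillings (w ∷ F) =
    ∈-concatMap-map⁺ _∷_ (∈-words (All.universal ∈-allLetters w)) (∈-fillings F)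

  fillings-unique : ∀ α → Unique (fillings k l α)
  fillings-unique []      = [] ∷ []
  fillings-unique (a ∷ α) =
    concatMap-map-unique _∷_ ∷-injective (words-unique a allLetters-unique) (fillings-unique α)

compositionsSortingTo-unique : ∀ lam → Unique (compositionsSortingTo lam)
compositionsSortingTo-unique lam =
  Unique.filter⁺ (λ α → T? ⌊ ≡-dec ℕ._≟_ (sortDesc α) lam ⌋)
  (Unique.filter⁺ (λ α → T? (sum α ≡ᵇ sum lam))
    (concatMap-unique (λ r → words-unique r (Unique.map⁺ ℕ.suc-injective (Unique.upTo⁺ (sum lam))))
                      (λ {r} → words-length r) (Unique.upTo⁺ (suc (sum lam)))))

∈-compositionsSortingTo⁻ : ∀ {lam α} → α ∈ compositionsSortingTo lam → sortDesc α ≡ lam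
∈-compositionsSortingTo⁻ {lam} α∈ =
  toWitness (proj₂ (∈-filter⁻ (λ α → T? ⌊ ≡-dec ℕ._≟_ (sortDesc α) lam ⌋) {xs = compositions (sum lam)} α∈))

length≤sum : ∀ {ns} → All (1 ≤_) ns → length ns ≤ sum ns
length≤sum []       = z≤n
length≤sum (p ∷ ps) = ℕ.+-mono-≤ p (length≤sum ps)

parts≤sum : ∀ ns → All (_≤ sum ns) ns
parts≤sum []       = []
parts≤sum (n ∷ ns) =
  ℕ.m≤m+n n (sum ns) ∷ All.map (λ le → ≤-trans le (ℕ.m≤n+m (sum ns) n)) (parts≤sum ns)

-- Positive parts keep `α` inside the finite enumeration: neither its length nor any part exceeds
-- its sum.
∈-compositionsSortingTo⁺ : ∀ {lam α} → IsPartition lam → sortDesc α ≡ lam → α ∈ compositionsSortingTo lam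
∈-compositionsSortingTo⁺ {lam} {α} (positive , _) sorted =
  ∈-filter⁺ (λ α → T? ⌊ ≡-dec ℕ._≟_ (sortDesc α) lam ⌋)
    (∈-filter⁺ (λ α → T? (sum α ≡ᵇ sum lam))
      (∈-concatMap⁺ (words (map suc (upTo (sum lam)))) {xs = upTo (suc (sum lam))}
        (lose (∈-upTo⁺ (s≤s (subst (length α ≤_) sumα (length≤sum positiveα))))
              (∈-words (All.zipWith part (positiveα , parts≤sum α)))))
      (ℕ.≡⇒≡ᵇ (sum α) (sum lam) sumα))
    (fromWitness sorted)
  where
  lam↭α : lam ↭ α
  lam↭α = subst (_↭ α) sorted (sortDesc-↭ α)

  sumα : sum α ≡ sum lam
  sumα = sym (sum-↭ lam↭α)

  positiveα : All (1 ≤_) α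
  positiveα = ↭.All-resp-↭ lam↭α positive

  part : ∀ {p} → 1 ≤ p × p ≤ sum α → p ∈ map suc (upTo (sum lam))
  part {suc p} (_ , le) = ∈-map⁺ suc (∈-upTo⁺ (subst (suc p ≤_) sumα le))

-- Contents and the lists of tableaux being counted

module _ {k l : ℕ} where

  occurrences-concat : ∀ a (F : Filling k l) → occurrences a F ≡ length (filterᵇ (eqL a) (concat F))
  occurrences-concat a []      = refl
  occurrences-concat a (w ∷ F) = sym (trans
    (cong length (filter-++ _ w (concat F)))
    (trans (length-++ (filterᵇ (eqL a) w)) (cong (_ +_) (sym (occurrences-concat a F)))))

  occurrences-↭ : ∀ a {F G : Filling k l} → concat F ↭ concat G → occurrences a F ≡ occurrences a G
  occurrences-↭ a {F} {G} p = trans (occurrences-concat a F)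
    (trans (↭.↭-length (↭.filter-↭ _ p)) (sym (occurrences-concat a G)))

  hasContent-↭ : ∀ {F G : Filling k l} v u → concat F ↭ concat G → hasContent F v u ≡ hasContent G v u
  hasContent-↭ {F} {G} v u p = cong₂ _∧_
    (cong and (map-cong (λ i → cong (_≡ᵇ lookup v i) (occurrences-↭ (inj₁ i) {F} {G} p)) (allFin k)))
    (cong and (map-cong (λ j → cong (_≡ᵇ lookup u j) (occurrences-↭ (inj₂ j) {F} {G} p)) (allFin l)))

  tableaux : (Letter k l → Bool) → List ℕ → Vec ℕ k → Vec ℕ l → List (Filling k l)
  tableaux s lam v u =
    concatMap (λ α → filterᵇ (λ F → tableauOK s F ∧ hasContent F v u) (fillings k l α))
              (compositionsSortingTo lam)

  tableaux-unique : ∀ s lam v u → Unique (tableaux s lam v u)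
  tableaux-unique s lam v u =
    concatMap-unique {key = map length} (λ α → Unique.filter⁺ _ (fillings-unique α))
      (λ {α} F∈ → fillings-shape α (proj₁ (∈-filter⁻ _ {xs = fillings k l α} F∈)))
      (compositionsSortingTo-unique lam)

  ∈-tableaux⁻ : ∀ s {lam} v u {F} → F ∈ tableaux s lam v u →
                sortDesc (map length F) ≡ lam × T (tableauOK s F ∧ hasContent F v u)
  ∈-tableaux⁻ s {lam} v u F∈
    with α , α∈ , F∈′ ← find (∈-concatMap⁻ _ {xs = compositionsSortingTo lam} F∈)
    with F∈″ , ok ← ∈-filter⁻ (λ F → T? (tableauOK s F ∧ hasContent F v u)) {xs = fillings k l α} F∈′ =
    trans (cong sortDesc (fillings-shape α F∈″)) (∈-compositionsSortingTo⁻ α∈) , ok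

  ∈-tableaux⁺ : ∀ s {lam} v u {F} → IsPartition lam → sortDesc (map length F) ≡ lam →
                T (tableauOK s F ∧ hasContent F v u) → F ∈ tableaux s lam v u
  ∈-tableaux⁺ s {lam} v u {F} part sorted ok =
    ∈-concatMap⁺ _ {xs = compositionsSortingTo lam}
      (lose {x = map length F} (∈-compositionsSortingTo⁺ part sorted)
            (∈-filter⁺ (λ F → T? (tableauOK s F ∧ hasContent F v u)) (∈-fillings F) ok))

nonEmptyRows : {A : Set} (F : List (List A)) → All (1 ≤_) (map length F) → ∃ λ F⁺ → F ≡ map toList F⁺
nonEmptyRows []             _        = [] , refl
nonEmptyRows ((x ∷ xs) ∷ F) (_ ∷ ps) =
  let F⁺ , e = nonEmptyRows F ps in (x ∷ xs) ∷ F⁺ , cong (_ ∷_) e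

toList-shape : {A : Set} (F : Tableau A) → map length (map toList F) ≡ shape F
toList-shape F = sym (map-∘ F)

semistandard-shape : {A : Set} {R C : Rel A 0ℓ} {T : Tableau A} → Semistandard R C T → Linked _≥_ (shape T)
semistandard-shape (_ , P) = Linked.map⁺ (AllPairs⇒Linked (AllPairs.map length-mono P))

semistandard-map : {A : Set} {R R′ C C′ : Rel A 0ℓ} →
  (∀ {a b} → R a b → R′ a b) → (∀ {a b} → C a b → C′ a b) →
  ∀ {T} → Semistandard R C T → Semistandard R′ C′ T
semistandard-map f g (K , P) = All.map (Linked.map f) K , AllPairs.map (Prefix.map g) P

-- Comparison of the two counts

module _ {k l : ℕ} {s s′ : Letter k l → Bool} (dual : ∀ a → s′ a ≡ not (s a)) where

  private
    R  = Increasing s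
    C  = Increasing (not ∘ s)
    R′ = Increasing s′
    C′ = Increasing (not ∘ s′)

    RC : Complementary R C
    RC = complementary s

    RC′ : Complementary R′ C′
    RC′ = complementary s′

  -- `s′` and `not ∘ s` agree pointwise only, so the transposed tableau is carried from the pair
  -- `C`, `R` to the pair `R′`, `C′`.
  transpose-dual : ∀ {T} → Semistandard R C T → Semistandard R′ C′ (transpose T)
  transpose-dual = semistandard-map
    (increasing-cong (sym ∘ dual))
    (increasing-cong (λ a → sym (trans (cong not (dual a)) (not-involutive (s a)))))
    ∘ transpose-semistandard RC
    where
    increasing-cong : ∀ {f g : Letter k l → Bool} → (∀ a → f a ≡ g a) →
                      ∀ {a b} → Increasing f a b → Increasing g a b
    increasing-cong f≡g (inj₁ p)       = inj₁ p
    increasing-cong f≡g (inj₂ (e , p)) = inj₂ (e , trans (sym (f≡g _)) p)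

  Transposed : Filling k l → Filling k l → Set
  Transposed F F′ = ∃ λ T → Semistandard R C T × (∃ λ G → Build R C T G × F ≡ map toList G)
                      × (∃ λ G′ → Build R′ C′ (transpose T) G′ × F′ ≡ map toList G′)

  toList-injective : ∀ {G H : Tableau (Letter k l)} → map toList G ≡ map toList H → G ≡ H
  toList-injective = map-injective λ { refl → refl }

  -- `F′` determines the transposed tableau since `Build` is injective on semistandard tableaux;
  -- that determines `T`, and `Build` is functional.
  Transposed-injective : ∀ {F₁ F₂ F′} → Transposed F₁ F′ → Transposed F₂ F′ → F₁ ≡ F₂
  Transposed-injective (T , ss , (G , b , refl) , (_ , b′ , refl)) (T₂ , ss₂ , (G₂ , b₂ , refl) , (_ , b₂′ , e))
    with refl ← toList-injective e
    with refl ← transpose-injective RC ss ss₂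
                  (build-injective RC′ (transpose-dual ss) (transpose-dual ss₂) b′ b₂′)
    with refl ← build-det RC b b₂ = refl

  Transposed-total : ∀ {lam} v u {F} → IsPartition lam → F ∈ tableaux s lam v u →
                     ∃ λ F′ → F′ ∈ tableaux s′ (conjugate lam) v u × Transposed F F′
  Transposed-total {lam} v u {F} part F∈ =
    let sorted , ok = ∈-tableaux⁻ s v u F∈
        G , F≡G     = nonEmptyRows F
          (↭.All-resp-↭ (subst (_↭ map length F) sorted (sortDesc-↭ _)) (proj₁ part))
        okF , contentF = to (T-∧ {tableauOK s F}) ok
        comp           = to (tableauOK⇔ s G) (subst (T ∘ tableauOK s) F≡G okF)
        T₁ , b , ss , _ = build-surjective RC _ refl comp
        G′ , b′ = build-total RC′ (transpose T₁)
        open Image sorted F≡G b ss b′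
    in map toList G′
     , ∈-tableaux⁺ s′ v u (conjugate-IsPartition part)
         (sortDesc-sorts (proj₂ (conjugate-IsPartition part)) shapes)
         (from T-∧
           ( from (tableauOK⇔ s′ G′) (build-composition RC′ (transpose-dual ss) b′)
           , subst T (hasContent-↭ {F = F} {map toList G′} v u contents) contentF))
     , T₁ , ss , (G , b , F≡G) , (G′ , b′ , refl)
    where
    module Image {G G′ T₁ : Tableau (Letter k l)} (sorted : sortDesc (map length F) ≡ lam) (F≡G : F ≡ map toList G)
                 (b : Build R C T₁ G) (ss : Semistandard R C T₁)
                 (b′ : Build R′ C′ (transpose T₁) G′) where

      shape-F : map length F ≡ shape G
      shape-F = trans (cong (map length) F≡G) (toList-shape G)

      -- A semistandard shape is already decreasing, so sorting the permuted row lengths of `F`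
      -- returns exactly this shape.
      shape-T : shape T₁ ≡ lam
      shape-T = trans (sym (sortDesc-sorts (semistandard-shape ss)
                       (↭-trans (↭-reflexive shape-F) (↭-sym (build-shape RC b))))) sorted

      shape-transpose : shape (transpose T₁) ≡ conjugate lam
      shape-transpose = trans (transpose-shape T₁)
        (trans (cong (foldr growParts []) shape-T) (sym (conjugate-foldr part)))

      shapes : map length (map toList G′) ↭ conjugate lam
      shapes = ↭-trans (↭-reflexive (toList-shape G′))
        (↭-trans (↭-sym (build-shape RC′ b′)) (↭-reflexive shape-transpose))

      contents : concat F ↭ entries G′
      contents = ↭-trans (↭-reflexive (cong concat F≡G)) (↭-trans (↭-sym (build-entries RC b))
        (↭-trans (↭-sym (transpose-entries RC ss)) (build-entries RC′ b′)))

  tableaux-≤ : ∀ {lam} v u → IsPartition lam →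
               length (tableaux s lam v u) ≤ length (tableaux s′ (conjugate lam) v u)
  tableaux-≤ {lam} v u part = length-≤-injection (tableaux-unique s lam v u)
    (Transposed-total v u part) Transposed-injective

theorem3p3 : (lam : List ℕ) → IsPartition lam → (k l : ℕ)
    → (v : Vec ℕ k) (u : Vec ℕ l)
    → sumHQcoeff k l lam v u ≡ sumRHQcoeff k l (conjugate lam) v u
theorem3p3 lam part k l v u = begin
  sumHQcoeff k l lam v u
    ≡⟨ length-concatMap _ (compositionsSortingTo lam) ⟨
  length (tableaux primed lam v u)
    ≡⟨ ℕ.≤-antisym (tableaux-≤ (λ a → sym (not-involutive (unprimed a))) v u part) ≥ ⟩
  length (tableaux unprimed (conjugate lam) v u)
    ≡⟨ length-concatMap _ (compositionsSortingTo (conjugate lam)) ⟩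
  sumRHQcoeff k l (conjugate lam) v u ∎
  where
  open ≡-Reasoning
  -- The same inequality, started from the conjugate with the selectors exchanged, ends at the
  -- double conjugate.
  ≥ : length (tableaux unprimed (conjugate lam) v u) ≤ length (tableaux primed lam v u)
  ≥ = subst (λ μ → length (tableaux unprimed (conjugate lam) v u) ≤ length (tableaux primed μ v u)) (conjugate-involutive part)
        (tableaux-≤ (λ _ → refl) v u (conjugate-IsPartition part))
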